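{- Let $G$ be a connected quiver with $n$ vertices and maximal vertex degree $d_1$. If $n \geq 4 d_1^2$, then $S_k(G) \leq B_k(G)$ for all $1 \leq k \leq n$.
   Context: A quiver $G$ is a finite undirected graph with $n\ge 1$ vertices in which loops (possibly several at the same vertex) and multiple edges between distinct vertices are allowed; finite simple graphs are the special case without loops and multiple connections. $m$ is the total number of edges, where every loop and every edge of a multiple connection is counted. The Kirchhoff matrix $K$ of $G$ is the symmetric $n\times n$ matrix with $K_{ij}=-(\text{number of edges between } i \text{ and } j)$ for $i\neq j$, and $K_{ii}=$ the degree of vertex $i$, i.e. the number of edges attached to $i$, counted with multiplicity, where each loop at $i$ counts as $1$. The maximal vertex degree $d_1$ is the largest diagonal entry of $K$. The eigenvalues of $K$ are $\lambda_1\ge\lambda_2\ge\dots\ge\lambda_n$, and $S_k(G)=\sum_{j=1}^k\lambda_j$. The redundancy $r$ is the minimal number of edges whose removal leaves no multiple connections between distinct vertices; equivalently $r=\sum_{i<j}(\mathrm{sign}(K_{ij})-K_{ij})$ (multiple loops at a vertex do not count as redundant). Set $B_k(G)=m+r+k(k+1)/2$. For a finite simple graph $r=0$, so $B_k(G)=m+k(k+1)/2$. -}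

module Defs where

open import Level using (0ℓ)
open import Algebra.Bundles using (CommutativeRing; Semiring)
import Algebra.Definitions.RawSemiring as RawSemiringDefs
open import Data.Bool.Base using (if_then_else_)
open import Data.Nat.Base as ℕ using (ℕ; zero; suc)
import Data.Nat.Properties as ℕ
open import Data.Nat.Induction using (<-wellFounded)
open import Data.Integer.Base as ℤ using (ℤ; +_)
open import Data.Rational.Base as ℚ using (ℚ; 0ℚ; 1ℚ; ½; ∣_∣)
import Data.Rational.Properties as ℚ
open import Data.Rational.Solver using (module +-*-Solver)
open import Data.Fin.Base as Fin using (Fin; zero; suc; toℕ; punchIn; inject≤)
import Data.Fin.Properties as Fin
open import Data.Fin.Subset as Subset using (Subset; _∉_; ⊤)
open import Data.Fin.Subset.Properties using (_∈?_; anySubset?; ∈⊤)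
open import Data.Vec.Base using (allFin; count)
open import Data.Vec.Functional using (Vector; foldr)
open import Data.Product.Base using (_×_; _,_; proj₁; proj₂; ∃; ∃-syntax)
open import Data.Product.Properties using (≡-dec)
open import Data.Sum.Base using (_⊎_)
open import Induction.WellFounded using (Acc; acc)
open import Relation.Nullary.Decidable
  using (yes; no; does; ¬?; _×-dec_; _⊎-dec_; _→-dec_)
open import Relation.Nullary.Negation using (contradiction)
open import Relation.Unary using (Pred; Decidable)
open import Relation.Binary.Structures using (IsEquivalence)
open import Relation.Binary.Construct.Closure.ReflexiveTransitive using (Star)
open import Relation.Binary.PropositionalEquality
  using (_≡_; _≢_; refl; sym; trans; cong; cong₂; subst)

open +-*-Solver using (solve; _:=_; _:+_; _:*_; _:-_; :-_)

IsCauchy : (ℕ → ℚ) → Set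
IsCauchy a = ∀ ε → 0ℚ ℚ.< ε → ∃[ N ] ∀ m n → N ℕ.≤ m → N ℕ.≤ n →
             ∣ a m ℚ.- a n ∣ ℚ.< ε

record ℝ : Set where
  constructor mkℝ
  field
    seq    : ℕ → ℚ
    cauchy : IsCauchy seq

open ℝ public

infix  4 _≃_ _≤ʳ_
infixl 6 _+ʳ_
infixl 7 _*ʳ_
infix  8 -ʳ_

_≃_ : ℝ → ℝ → Set
x ≃ y = ∀ ε → 0ℚ ℚ.< ε → ∃[ N ] ∀ n → N ℕ.≤ n → ∣ seq x n ℚ.- seq y n ∣ ℚ.< ε

_≤ʳ_ : ℝ → ℝ → Set
x ≤ʳ y = ∀ ε → 0ℚ ℚ.< ε → ∃[ N ] ∀ n → N ℕ.≤ n → seq x n ℚ.< seq y n ℚ.+ ε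

∣p-p∣≡0 : ∀ p → ∣ p ℚ.- p ∣ ≡ 0ℚ
∣p-p∣≡0 p = cong ∣_∣ (ℚ.+-inverseʳ p)

∣p-q∣≡∣q-p∣ : ∀ p q → ∣ p ℚ.- q ∣ ≡ ∣ q ℚ.- p ∣
∣p-q∣≡∣q-p∣ p q = trans (sym (ℚ.∣-p∣≡∣p∣ (p ℚ.- q))) (cong ∣_∣ (lemma p q))
  where
  lemma : ∀ p q → ℚ.- (p ℚ.- q) ≡ q ℚ.- p
  lemma = solve 2 (λ p q → :- (p :- q) := q :- p) refl

half-pos : ∀ {ε} → 0ℚ ℚ.< ε → 0ℚ ℚ.< ½ ℚ.* ε
half-pos {ε} 0<ε = subst (ℚ._< ½ ℚ.* ε) (ℚ.*-zeroʳ ½) (ℚ.*-monoʳ-<-pos ½ 0<ε)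

half+half : ∀ ε → ½ ℚ.* ε ℚ.+ ½ ℚ.* ε ≡ ε
half+half ε = trans (sym (ℚ.*-distribʳ-+ ε ½ ½)) (ℚ.*-identityˡ ε)

+-close : ∀ {ε} a a′ b b′ → ∣ a ℚ.- a′ ∣ ℚ.< ½ ℚ.* ε → ∣ b ℚ.- b′ ∣ ℚ.< ½ ℚ.* ε →
          ∣ (a ℚ.+ b) ℚ.- (a′ ℚ.+ b′) ∣ ℚ.< ε
+-close {ε} a a′ b b′ p q = begin-strict
  ∣ (a ℚ.+ b) ℚ.- (a′ ℚ.+ b′) ∣          ≡⟨ cong ∣_∣ (lemma a a′ b b′) ⟩
  ∣ (a ℚ.- a′) ℚ.+ (b ℚ.- b′) ∣          ≤⟨ ℚ.∣p+q∣≤∣p∣+∣q∣ (a ℚ.- a′) (b ℚ.- b′) ⟩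
  ∣ a ℚ.- a′ ∣ ℚ.+ ∣ b ℚ.- b′ ∣          <⟨ ℚ.+-mono-< p q ⟩
  ½ ℚ.* ε ℚ.+ ½ ℚ.* ε                    ≡⟨ half+half ε ⟩
  ε                                      ∎
  where
  open ℚ.≤-Reasoning
  lemma : ∀ a a′ b b′ → (a ℚ.+ b) ℚ.- (a′ ℚ.+ b′) ≡ (a ℚ.- a′) ℚ.+ (b ℚ.- b′)
  lemma = solve 4 (λ a a′ b b′ → (a :+ b) :- (a′ :+ b′) := (a :- a′) :+ (b :- b′)) refl

-‿close : ∀ a b → ∣ (ℚ.- a) ℚ.- (ℚ.- b) ∣ ≡ ∣ a ℚ.- b ∣
-‿close a b = trans (cong ∣_∣ (lemma a b)) (∣p-q∣≡∣q-p∣ b a)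
  where
  lemma : ∀ a b → (ℚ.- a) ℚ.- (ℚ.- b) ≡ b ℚ.- a
  lemma = solve 2 (λ a b → (:- a) :- (:- b) := b :- a) refl

bounded : ∀ x → ∃[ M ] ℚ.Positive M × ∃[ N ] ∀ n → N ℕ.≤ n → ∣ seq x n ∣ ℚ.≤ M
bounded x = ∣ a ∣ ℚ.+ 1ℚ , M-pos , N , bound
  where
  N = proj₁ (cauchy x 1ℚ (ℚ.positive⁻¹ 1ℚ))
  a = seq x N
  M-pos : ℚ.Positive (∣ a ∣ ℚ.+ 1ℚ)
  M-pos = ℚ.nonNeg+pos⇒pos ∣ a ∣ {{ℚ.∣-∣-nonNeg a}} 1ℚ
  lemma : ∀ p q → p ≡ q ℚ.+ (p ℚ.- q)
  lemma = solve 2 (λ p q → p := q :+ (p :- q)) refl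
  open ℚ.≤-Reasoning
  bound : ∀ n → N ℕ.≤ n → ∣ seq x n ∣ ℚ.≤ ∣ a ∣ ℚ.+ 1ℚ
  bound n N≤n = begin
    ∣ seq x n ∣                      ≡⟨ cong ∣_∣ (lemma (seq x n) a) ⟩
    ∣ a ℚ.+ (seq x n ℚ.- a) ∣        ≤⟨ ℚ.∣p+q∣≤∣p∣+∣q∣ a (seq x n ℚ.- a) ⟩
    ∣ a ∣ ℚ.+ ∣ seq x n ℚ.- a ∣      ≤⟨ ℚ.+-monoʳ-≤ ∣ a ∣ (ℚ.<⇒≤
                                          (proj₂ (cauchy x 1ℚ (ℚ.positive⁻¹ 1ℚ)) n N N≤n ℕ.≤-refl)) ⟩
    ∣ a ∣ ℚ.+ 1ℚ                     ∎

module _ (A B : ℚ) (A-pos : ℚ.Positive A) (B-pos : ℚ.Positive B) where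
  private instance
    _ = A-pos
    _ = B-pos
    A+B-pos : ℚ.Positive (A ℚ.+ B)
    A+B-pos = ℚ.pos+pos⇒pos A B
    A+B-nonZero : ℚ.NonZero (A ℚ.+ B)
    A+B-nonZero = ℚ.pos⇒nonZero (A ℚ.+ B)

  *-modulus : ℚ → ℚ
  *-modulus ε = ε ℚ.* (ℚ.1/ (A ℚ.+ B))

  *-modulus-pos : ∀ {ε} → 0ℚ ℚ.< ε → 0ℚ ℚ.< *-modulus ε
  *-modulus-pos {ε} 0<ε = subst (ℚ._< *-modulus ε) (ℚ.*-zeroˡ (ℚ.1/ (A ℚ.+ B)))
    (ℚ.*-monoˡ-<-pos (ℚ.1/ (A ℚ.+ B)) {{ℚ.1/pos⇒pos (A ℚ.+ B)}} 0<ε)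

  *-close : ∀ {ε} a a′ b b′ → ∣ a ∣ ℚ.≤ A → ∣ b′ ∣ ℚ.≤ B →
            ∣ a ℚ.- a′ ∣ ℚ.< *-modulus ε → ∣ b ℚ.- b′ ∣ ℚ.< *-modulus ε →
            ∣ a ℚ.* b ℚ.- a′ ℚ.* b′ ∣ ℚ.< ε
  *-close {ε} a a′ b b′ a≤A b′≤B p q = begin-strict
    ∣ a ℚ.* b ℚ.- a′ ℚ.* b′ ∣
      ≡⟨ cong ∣_∣ (lemma a a′ b b′) ⟩
    ∣ a ℚ.* (b ℚ.- b′) ℚ.+ b′ ℚ.* (a ℚ.- a′) ∣
      ≤⟨ ℚ.∣p+q∣≤∣p∣+∣q∣ (a ℚ.* (b ℚ.- b′)) (b′ ℚ.* (a ℚ.- a′)) ⟩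
    ∣ a ℚ.* (b ℚ.- b′) ∣ ℚ.+ ∣ b′ ℚ.* (a ℚ.- a′) ∣
      ≡⟨ cong₂ ℚ._+_ (ℚ.∣p*q∣≡∣p∣*∣q∣ a _) (ℚ.∣p*q∣≡∣p∣*∣q∣ b′ _) ⟩
    ∣ a ∣ ℚ.* ∣ b ℚ.- b′ ∣ ℚ.+ ∣ b′ ∣ ℚ.* ∣ a ℚ.- a′ ∣
      ≤⟨ ℚ.+-mono-≤
           (ℚ.*-monoʳ-≤-nonNeg ∣ b ℚ.- b′ ∣ {{ℚ.∣-∣-nonNeg (b ℚ.- b′)}} a≤A)
           (ℚ.*-monoʳ-≤-nonNeg ∣ a ℚ.- a′ ∣ {{ℚ.∣-∣-nonNeg (a ℚ.- a′)}} b′≤B) ⟩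
    A ℚ.* ∣ b ℚ.- b′ ∣ ℚ.+ B ℚ.* ∣ a ℚ.- a′ ∣
      <⟨ ℚ.+-mono-< (ℚ.*-monoʳ-<-pos A q) (ℚ.*-monoʳ-<-pos B p) ⟩
    A ℚ.* *-modulus ε ℚ.+ B ℚ.* *-modulus ε
      ≡⟨ collect A B ε (ℚ.1/ (A ℚ.+ B)) ⟩
    ε ℚ.* ((A ℚ.+ B) ℚ.* (ℚ.1/ (A ℚ.+ B)))
      ≡⟨ cong (ε ℚ.*_) (ℚ.*-inverseʳ (A ℚ.+ B)) ⟩
    ε ℚ.* 1ℚ
      ≡⟨ ℚ.*-identityʳ ε ⟩
    ε ∎
    where
    open ℚ.≤-Reasoning
    lemma : ∀ a a′ b b′ →
            a ℚ.* b ℚ.- a′ ℚ.* b′ ≡ a ℚ.* (b ℚ.- b′) ℚ.+ b′ ℚ.* (a ℚ.- a′)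
    lemma = solve 4 (λ a a′ b b′ → a :* b :- a′ :* b′ := a :* (b :- b′) :+ b′ :* (a :- a′)) refl
    collect : ∀ A B e i → A ℚ.* (e ℚ.* i) ℚ.+ B ℚ.* (e ℚ.* i) ≡ e ℚ.* ((A ℚ.+ B) ℚ.* i)
    collect = solve 4 (λ A B e i → A :* (e :* i) :+ B :* (e :* i) := e :* ((A :+ B) :* i)) refl

abstract
  const-cauchy : ∀ q → IsCauchy (λ _ → q)
  const-cauchy q ε 0<ε = 0 , λ _ _ _ _ → subst (ℚ._< ε) (sym (∣p-p∣≡0 q)) 0<ε

fromℚ : ℚ → ℝ
fromℚ q = mkℝ (λ _ → q) (const-cauchy q)

fromℤ : ℤ → ℝ
fromℤ z = fromℚ (z ℚ./ 1)

fromℕ : ℕ → ℝ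
fromℕ n = fromℤ (+ n)

abstract
  +-cauchy : ∀ x y → IsCauchy (λ n → seq x n ℚ.+ seq y n)
  +-cauchy x y ε 0<ε =
    let M , p = cauchy x (½ ℚ.* ε) (half-pos 0<ε)
        N , q = cauchy y (½ ℚ.* ε) (half-pos 0<ε)
    in M ℕ.⊔ N , λ m n l l′ → +-close (seq x m) (seq x n) (seq y m) (seq y n)
         (p m n (ℕ.m⊔n≤o⇒m≤o M N l) (ℕ.m⊔n≤o⇒m≤o M N l′))
         (q m n (ℕ.m⊔n≤o⇒n≤o M N l) (ℕ.m⊔n≤o⇒n≤o M N l′))

_+ʳ_ : ℝ → ℝ → ℝ
x +ʳ y = mkℝ (λ n → seq x n ℚ.+ seq y n) (+-cauchy x y)

abstract
  -‿cauchy : ∀ x → IsCauchy (λ n → ℚ.- seq x n)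
  -‿cauchy x ε 0<ε =
    let N , p = cauchy x ε 0<ε
    in N , λ m n l l′ → subst (ℚ._< ε) (sym (-‿close (seq x m) (seq x n))) (p m n l l′)

-ʳ_ : ℝ → ℝ
-ʳ x = mkℝ (λ n → ℚ.- seq x n) (-‿cauchy x)

abstract
  *-cauchy : ∀ x y → IsCauchy (λ n → seq x n ℚ.* seq y n)
  *-cauchy x y ε 0<ε =
    let A , A-pos , N₁ , ∣x∣≤A = bounded x
        B , B-pos , N₂ , ∣y∣≤B = bounded y
        δ   = *-modulus A B A-pos B-pos ε
        0<δ = *-modulus-pos A B A-pos B-pos 0<ε
        N₃ , p = cauchy x δ 0<δ
        N₄ , q = cauchy y δ 0<δ
        N₁₂ = N₁ ℕ.⊔ N₂
        N₃₄ = N₃ ℕ.⊔ N₄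
        l₁₂ : ∀ {n} → N₁₂ ℕ.⊔ N₃₄ ℕ.≤ n → N₁₂ ℕ.≤ n
        l₁₂ = ℕ.m⊔n≤o⇒m≤o N₁₂ N₃₄
        l₃₄ : ∀ {n} → N₁₂ ℕ.⊔ N₃₄ ℕ.≤ n → N₃₄ ℕ.≤ n
        l₃₄ = ℕ.m⊔n≤o⇒n≤o N₁₂ N₃₄
    in N₁₂ ℕ.⊔ N₃₄ , λ m n l l′ →
       *-close A B A-pos B-pos (seq x m) (seq x n) (seq y m) (seq y n)
         (∣x∣≤A m (ℕ.m⊔n≤o⇒m≤o N₁ N₂ (l₁₂ l)))
         (∣y∣≤B n (ℕ.m⊔n≤o⇒n≤o N₁ N₂ (l₁₂ l′)))
         (p m n (ℕ.m⊔n≤o⇒m≤o N₃ N₄ (l₃₄ l)) (ℕ.m⊔n≤o⇒m≤o N₃ N₄ (l₃₄ l′)))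
         (q m n (ℕ.m⊔n≤o⇒n≤o N₃ N₄ (l₃₄ l)) (ℕ.m⊔n≤o⇒n≤o N₃ N₄ (l₃₄ l′)))

_*ʳ_ : ℝ → ℝ → ℝ
x *ʳ y = mkℝ (λ n → seq x n ℚ.* seq y n) (*-cauchy x y)

abstract
  pointwise : ∀ x y → (∀ n → seq x n ≡ seq y n) → x ≃ y
  pointwise x y eq ε 0<ε = 0 , λ n _ →
    subst (ℚ._< ε) (sym (trans (cong (λ q → ∣ q ℚ.- seq y n ∣) (eq n)) (∣p-p∣≡0 (seq y n)))) 0<ε

  ≃-sym : ∀ {x y} → x ≃ y → y ≃ x
  ≃-sym {x} {y} x≃y ε 0<ε =
    let N , p = x≃y ε 0<ε
    in N , λ n l → subst (ℚ._< ε) (∣p-q∣≡∣q-p∣ (seq x n) (seq y n)) (p n l)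

  ≃-trans : ∀ {x y z} → x ≃ y → y ≃ z → x ≃ z
  ≃-trans {x} {y} {z} x≃y y≃z ε 0<ε =
    let M , p = x≃y (½ ℚ.* ε) (half-pos 0<ε)
        N , q = y≃z (½ ℚ.* ε) (half-pos 0<ε)
    in M ℕ.⊔ N , λ n l → subst (λ d → ∣ d ∣ ℚ.< ε) (lemma (seq x n) (seq y n) (seq z n))
         (+-close (seq x n) (seq y n) (seq y n) (seq z n)
           (p n (ℕ.m⊔n≤o⇒m≤o M N l)) (q n (ℕ.m⊔n≤o⇒n≤o M N l)))
    where
    lemma : ∀ a b c → (a ℚ.+ b) ℚ.- (b ℚ.+ c) ≡ a ℚ.- c
    lemma = solve 3 (λ a b c → (a :+ b) :- (b :+ c) := a :- c) refl

  ≃-isEquivalence : IsEquivalence _≃_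
  ≃-isEquivalence = record
    { refl  = λ {x} → pointwise x x (λ _ → refl)
    ; sym   = λ {x} {y} → ≃-sym {x} {y}
    ; trans = λ {x} {y} {z} → ≃-trans {x} {y} {z}
    }

  +ʳ-cong : ∀ {x x′ y y′} → x ≃ x′ → y ≃ y′ → x +ʳ y ≃ x′ +ʳ y′
  +ʳ-cong {x} {x′} {y} {y′} x≃x′ y≃y′ ε 0<ε =
    let M , p = x≃x′ (½ ℚ.* ε) (half-pos 0<ε)
        N , q = y≃y′ (½ ℚ.* ε) (half-pos 0<ε)
    in M ℕ.⊔ N , λ n l → +-close (seq x n) (seq x′ n) (seq y n) (seq y′ n)
         (p n (ℕ.m⊔n≤o⇒m≤o M N l)) (q n (ℕ.m⊔n≤o⇒n≤o M N l))

  -ʳ-cong : ∀ {x y} → x ≃ y → -ʳ x ≃ -ʳ y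
  -ʳ-cong {x} {y} x≃y ε 0<ε =
    let N , p = x≃y ε 0<ε
    in N , λ n l → subst (ℚ._< ε) (sym (-‿close (seq x n) (seq y n))) (p n l)

  *ʳ-cong : ∀ {x x′ y y′} → x ≃ x′ → y ≃ y′ → x *ʳ y ≃ x′ *ʳ y′
  *ʳ-cong {x} {x′} {y} {y′} x≃x′ y≃y′ ε 0<ε =
    let A , A-pos , N₁ , ∣x∣≤A  = bounded x
        B , B-pos , N₂ , ∣y′∣≤B = bounded y′
        δ   = *-modulus A B A-pos B-pos ε
        0<δ = *-modulus-pos A B A-pos B-pos 0<ε
        N₃ , p = x≃x′ δ 0<δ
        N₄ , q = y≃y′ δ 0<δ
        N₁₂ = N₁ ℕ.⊔ N₂
        N₃₄ = N₃ ℕ.⊔ N₄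
    in N₁₂ ℕ.⊔ N₃₄ , λ n l →
       *-close A B A-pos B-pos (seq x n) (seq x′ n) (seq y n) (seq y′ n)
         (∣x∣≤A  n (ℕ.m⊔n≤o⇒m≤o N₁ N₂ (ℕ.m⊔n≤o⇒m≤o N₁₂ N₃₄ l)))
         (∣y′∣≤B n (ℕ.m⊔n≤o⇒n≤o N₁ N₂ (ℕ.m⊔n≤o⇒m≤o N₁₂ N₃₄ l)))
         (p n (ℕ.m⊔n≤o⇒m≤o N₃ N₄ (ℕ.m⊔n≤o⇒n≤o N₁₂ N₃₄ l)))
         (q n (ℕ.m⊔n≤o⇒n≤o N₃ N₄ (ℕ.m⊔n≤o⇒n≤o N₁₂ N₃₄ l)))

ℝ-commutativeRing : CommutativeRing 0ℓ 0ℓ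
ℝ-commutativeRing = record
  { Carrier = ℝ
  ; _≈_     = _≃_
  ; _+_     = _+ʳ_
  ; _*_     = _*ʳ_
  ; -_      = -ʳ_
  ; 0#      = fromℚ 0ℚ
  ; 1#      = fromℚ 1ℚ
  ; isCommutativeRing = record
    { isRing = record
      { +-isAbelianGroup = record
        { isGroup = record
          { isMonoid = record
            { isSemigroup = record
              { isMagma = record
                { isEquivalence = ≃-isEquivalence
                ; ∙-cong = λ {x} {x′} {y} {y′} → +ʳ-cong {x} {x′} {y} {y′}
                }
              ; assoc = λ x y z → pointwise ((x +ʳ y) +ʳ z) (x +ʳ (y +ʳ z))
                  (λ n → ℚ.+-assoc (seq x n) (seq y n) (seq z n))
              }
            ; identity = (λ x → pointwise (fromℚ 0ℚ +ʳ x) x (λ n → ℚ.+-identityˡ (seq x n)))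
                       , (λ x → pointwise (x +ʳ fromℚ 0ℚ) x (λ n → ℚ.+-identityʳ (seq x n)))
            }
          ; inverse = (λ x → pointwise ((-ʳ x) +ʳ x) (fromℚ 0ℚ) (λ n → ℚ.+-inverseˡ (seq x n)))
                    , (λ x → pointwise (x +ʳ (-ʳ x)) (fromℚ 0ℚ) (λ n → ℚ.+-inverseʳ (seq x n)))
          ; ⁻¹-cong = λ {x} {y} → -ʳ-cong {x} {y}
          }
        ; comm = λ x y → pointwise (x +ʳ y) (y +ʳ x) (λ n → ℚ.+-comm (seq x n) (seq y n))
        }
      ; *-cong = λ {x} {x′} {y} {y′} → *ʳ-cong {x} {x′} {y} {y′}
      ; *-assoc = λ x y z → pointwise ((x *ʳ y) *ʳ z) (x *ʳ (y *ʳ z))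
          (λ n → ℚ.*-assoc (seq x n) (seq y n) (seq z n))
      ; *-identity = (λ x → pointwise (fromℚ 1ℚ *ʳ x) x (λ n → ℚ.*-identityˡ (seq x n)))
                   , (λ x → pointwise (x *ʳ fromℚ 1ℚ) x (λ n → ℚ.*-identityʳ (seq x n)))
      ; distrib =
            (λ x y z → pointwise (x *ʳ (y +ʳ z)) (x *ʳ y +ʳ x *ʳ z)
              (λ n → ℚ.*-distribˡ-+ (seq x n) (seq y n) (seq z n)))
          , (λ x y z → pointwise ((y +ʳ z) *ʳ x) (y *ʳ x +ʳ z *ʳ x)
              (λ n → ℚ.*-distribʳ-+ (seq x n) (seq y n) (seq z n)))
      }
    ; *-comm = λ x y → pointwise (x *ʳ y) (y *ʳ x) (λ n → ℚ.*-comm (seq x n) (seq y n))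
    }
  }

Matrix : Set → ℕ → Set
Matrix A n = Fin n → Fin n → A

module LinearAlgebra (R : CommutativeRing 0ℓ 0ℓ) where
  open CommutativeRing R using (Carrier; semiring; 0#; 1#; -_; _*_; _-_)
  open RawSemiringDefs (Semiring.rawSemiring semiring) using (sum; _^_)

  det : ∀ {n} → Matrix Carrier n → Carrier
  det {zero}  A = 1#
  det {suc n} A = sum λ j →
    (- 1#) ^ toℕ j * (A zero j * det (λ i k → A (suc i) (punchIn j k)))

  identity : ∀ {n} → Matrix Carrier n
  identity i j = if does (i Fin.≟ j) then 1# else 0#

  charPoly : ∀ {n} → Matrix Carrier n → Carrier → Carrier
  charPoly A x = det (λ i j → x * identity i j - A i j)

open LinearAlgebra ℝ-commutativeRing public
open RawSemiringDefs (Semiring.rawSemiring (CommutativeRing.semiring ℝ-commutativeRing)) public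
  using (sum; product)

-- ev lists the eigenvalues with algebraic multiplicity: ℝ is infinite, so the
-- equality of functions det (x I - A) = ∏ᵢ (x - evᵢ) is one of polynomials.
IsSpectrum : ∀ {n} → Matrix ℝ n → Vector ℝ n → Set
IsSpectrum A ev =
  (∀ i j → i Fin.≤ j → ev j ≤ʳ ev i) ×
  (∀ x → charPoly A x ≃ product (λ i → x +ʳ (-ʳ ev i)))

partialSum : ∀ {n} → Vector ℝ n → ∀ {k} → k ℕ.≤ n → ℝ
partialSum ev k≤n = sum (λ i → ev (inject≤ i k≤n))

-- The edge e joins the two components of ends e; their order carries no
-- meaning, and every notion below is insensitive to it.
record Quiver : Set where
  field
    n : ℕ
    {{n-nonZero}} : ℕ.NonZero n
    m : ℕ
    ends : Fin m → Fin n × Fin n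

module _ (G : Quiver) where
  open Quiver G

  Joins : Fin m → Fin n → Fin n → Set
  Joins e i j = ends e ≡ (i , j) ⊎ ends e ≡ (j , i)

  joins? : ∀ i j → Decidable (λ e → Joins e i j)
  joins? i j e = ≡-dec Fin._≟_ Fin._≟_ (ends e) (i , j) ⊎-dec
                 ≡-dec Fin._≟_ Fin._≟_ (ends e) (j , i)

  Attached : Fin m → Fin n → Set
  Attached e i = proj₁ (ends e) ≡ i ⊎ proj₂ (ends e) ≡ i

  attached? : ∀ i → Decidable (λ e → Attached e i)
  attached? i e = (proj₁ (ends e) Fin.≟ i) ⊎-dec (proj₂ (ends e) Fin.≟ i)

  Connected : Set
  Connected = ∀ i j → Star (λ u v → ∃[ e ] Joins e u v) i j

  multiplicity : Fin n → Fin n → ℕ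
  multiplicity i j = count (joins? i j) (allFin m)

  -- A loop at i is a single edge attached to i, hence contributes 1.
  degree : Vector ℕ n
  degree i = count (attached? i) (allFin m)

  maxDegree : ℕ
  maxDegree = foldr ℕ._⊔_ 0 degree

  kirchhoff : Matrix ℤ n
  kirchhoff i j = if does (i Fin.≟ j) then + degree i else ℤ.- (+ multiplicity i j)

  NoMultipleAfterRemoving : Subset m → Set
  NoMultipleAfterRemoving S = ∀ i j → i ≢ j → ∀ e f →
    e ∉ S → f ∉ S → Joins e i j → Joins f i j → e ≡ f

  noMultipleAfterRemoving? : Decidable NoMultipleAfterRemoving
  noMultipleAfterRemoving? S =
    Fin.all? λ i → Fin.all? λ j → ¬? (i Fin.≟ j) →-dec (Fin.all? λ e → Fin.all? λ f →
      ¬? (e ∈? S) →-dec (¬? (f ∈? S) →-dec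
        (joins? i j e →-dec (joins? i j f →-dec (e Fin.≟ f)))))

IsMinimum : ∀ {m} → Pred (Subset m) 0ℓ → Subset m → Set
IsMinimum P S = P S × (∀ T → P T → Subset.∣ S ∣ ℕ.≤ Subset.∣ T ∣)

minimum : ∀ {m} {P : Pred (Subset m) 0ℓ} → Decidable P → ∃ P → ∃ (IsMinimum P)
minimum {m} {P} P? (S₀ , PS₀) = go S₀ PS₀ (<-wellFounded _)
  where
  go : ∀ S → P S → Acc ℕ._<_ Subset.∣ S ∣ → ∃ (IsMinimum P)
  go S PS (acc rs) with anySubset? (λ T → P? T ×-dec (Subset.∣ T ∣ ℕ.<? Subset.∣ S ∣))
  ... | yes (T , PT , T<S) = go T PT (rs T<S)
  ... | no ∄T = S , PS , λ T PT → ℕ.≮⇒≥ (λ T<S → ∄T (T , PT , T<S))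

minimalRemoval : ∀ G → ∃ (IsMinimum (NoMultipleAfterRemoving G))
minimalRemoval G = minimum (noMultipleAfterRemoving? G)
  (⊤ , λ _ _ _ e _ e∉⊤ _ _ _ → contradiction ∈⊤ e∉⊤)

redundancy : Quiver → ℕ
redundancy G = Subset.∣ proj₁ (minimalRemoval G) ∣

-- k (k + 1) is even, so the division does not round.
brouwerBound : Quiver → ℕ → ℕ
brouwerBound G k = Quiver.m G ℕ.+ redundancy G ℕ.+ (k ℕ.* (k ℕ.+ 1)) ℕ./ 2

kirchhoffℝ : ∀ G → Matrix ℝ (Quiver.n G)
kirchhoffℝ G i j = fromℤ (kirchhoff G i j)

{-# OPTIONS --safe #-}

-- Every eigenvalue is at most 2d, where d is the maximal degree: for x ≥ 2d + ε the matrix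
-- x - K is strictly diagonally dominant, so det (x - K) ≥ εⁿ, while det (x - K) vanishes at an
-- eigenvalue. Hence S_k ≤ 2dk. A connected quiver has m ≥ n - 1 ≥ 4d² - 1 edges, which gives
-- 2m ≥ 4d² for d ≥ 1, so 4dk ≤ (2d)² + k² ≤ 2m + k(k + 1).
module Submission where

open import Defs
open import Data.Nat.Base using (ℕ; _≤_; _*_; _^_)
open import Data.Vec.Functional using (Vector)

open import Level using (0ℓ)
open import Algebra.Bundles using (CommutativeRing; CommutativeSemiring)
import Algebra.Properties.Semiring.Sum
open import Data.Fin.Base as Fin using (Fin; zero; suc; toℕ; inject₁; inject≤; punchIn; punchOut)
import Data.Fin.Properties as Fin
open import Data.Fin.Induction using (<-weakInduction)
open import Data.Integer.Base as ℤ using (+_)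
import Data.Integer.Properties as ℤ
open import Data.Nat.Base as ℕ using (zero; suc)
import Data.Nat.Properties as ℕ
open import Data.Nat.DivMod using (m*n/n≡m; /-monoˡ-≤)
open import Data.Nat.Solver using () renaming (module +-*-Solver to ℕ-Solver)
open import Data.Product.Base using (_×_; _,_; proj₁; proj₂; ∃-syntax)
open import Data.Rational.Base as ℚ using (ℚ; 0ℚ; 1ℚ; ½; ∣_∣)
import Data.Rational.Properties as ℚ
import Data.Rational.Unnormalised.Base as ℚᵘ
import Data.Rational.Unnormalised.Properties as ℚᵘ
open import Data.Rational.Solver using (module +-*-Solver)
open import Data.Sum.Base using (_⊎_; inj₁; inj₂)
open import Data.Vec.Base as Vec using (Vec; count; allFin)
open import Data.Vec.Functional using (foldr; updateAt; _∷_)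
import Data.Vec.Functional.Properties as Vector
open import Function.Base using (_∘_; id)
open import Relation.Nullary.Decidable using (yes; no; ¬?; _×-dec_)
open import Relation.Nullary.Negation using (contradiction)
open import Relation.Unary using (Pred; Decidable)
open import Relation.Binary.Construct.Closure.ReflexiveTransitive as Star using (Star; _◅_)
open import Relation.Binary.PropositionalEquality
  using (_≡_; _≢_; refl; sym; trans; cong; cong₂; subst; subst₂)

-- Determinants

-- `IsSpectrum` supplies a factorisation of the characteristic polynomial and no eigenvectors, so
-- the eigenvalue bound is extracted from the determinant instead of from the largest coordinate of
-- an eigenvector. Mere non-vanishing would be too weak: reals are Cauchy sequences without a
-- decidable order. What is used is a positive lower bound for the determinant at single rational
-- terms of the sequence, where pivots can be compared and inverted. Since `det` is an expansion
-- along the first row, the column operations behind elimination have to be derived from linearity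
-- in each column.

module Determinant (R : CommutativeRing 0ℓ 0ℓ) where
  open CommutativeRing R hiding (zero) renaming (_*_ to _·_; refl to ≈-refl; sym to ≈-sym; trans to ≈-trans)
  open import Algebra.Definitions.RawSemiring (CommutativeSemiring.rawSemiring commutativeSemiring)
    using () renaming (_^_ to _^ᴿ_)
  open import Algebra.Properties.Semiring.Sum semiring
    using (sum-cong-≋; ∑-distrib-+; *-distribˡ-sum; sum-replicate-zero) renaming (sum to ∑)
  open import Algebra.Properties.Ring ring using (-1*x≈-x)
  open import Algebra.Solver.Ring.NaturalCoefficients.Default commutativeSemiring
    using (solve; _:=_; _:+_; _:*_)
  open import Relation.Binary.Reasoning.Setoid setoid
  private module L = LinearAlgebra R

  private
    Mat : ℕ → Set
    Mat = Matrix Carrier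

  minor : ∀ {n} → Mat (suc n) → Fin (suc n) → Mat n
  minor A j i k = A (suc i) (punchIn j k)

  laplace : ∀ {n} → Mat (suc n) → Vector Carrier (suc n)
  laplace A j = (- 1#) ^ᴿ toℕ j · (A zero j · L.det (minor A j))

  _[_≔_] : ∀ {n} → Mat n → Fin n → Vector Carrier n → Mat n
  (A [ p ≔ c ]) i = updateAt (A i) p (λ _ → c i)

  ≔-at : ∀ {n} (A : Mat n) p c i → (A [ p ≔ c ]) i p ≈ c i
  ≔-at A p c i = reflexive (Vector.updateAt-updates p (A i))

  ≔-off : ∀ {n} (A : Mat n) p c i j → j ≢ p → (A [ p ≔ c ]) i j ≈ A i j
  ≔-off A p c i j j≢p = reflexive (Vector.updateAt-minimal j p (A i) j≢p)

  det-cong : ∀ {n} {A B : Mat n} → (∀ i j → A i j ≈ B i j) → L.det A ≈ L.det B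
  det-cong {zero}  A≈B = ≈-refl
  det-cong {suc n} A≈B = sum-cong-≋ λ j → *-congˡ {(- 1#) ^ᴿ toℕ j}
    (*-cong (A≈B zero j) (det-cong λ i k → A≈B (suc i) (punchIn j k)))

  -- Deleting column `j = p` leaves minors on which all three matrices agree. For `j ≢ p` the
  -- entries agree and the minors again differ in one column only. Pointwise hypotheses, rather than
  -- explicit column updates, let the induction apply to these minors.
  det-linear : ∀ {n} p y {A B C : Mat n} →
    (∀ i → A i p ≈ B i p + y · C i p) →
    (∀ i j → j ≢ p → A i j ≈ B i j) → (∀ i j → j ≢ p → A i j ≈ C i j) →
    L.det A ≈ L.det B + y · L.det C
  det-linear {suc n} p y {A} {B} {C} at-p A≈B A≈C = begin
    ∑ (laplace A)                                ≈⟨ sum-cong-≋ term ⟩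
    ∑ (λ j → laplace B j + y · laplace C j)      ≈⟨ ∑-distrib-+ (laplace B) (λ j → y · laplace C j) ⟩
    ∑ (laplace B) + ∑ (λ j → y · laplace C j)    ≈⟨ +-congˡ (*-distribˡ-sum y (laplace C)) ⟨
    ∑ (laplace B) + y · ∑ (laplace C)            ∎
    where
    split-entry : ∀ s b c y m → s · ((b + y · c) · m) ≈ s · (b · m) + y · (s · (c · m))
    split-entry = solve 5 (λ s b c y m →
      (s :* ((b :+ y :* c) :* m)) := (s :* (b :* m) :+ y :* (s :* (c :* m)))) ≈-refl
    split-minor : ∀ s a m y l → s · (a · (m + y · l)) ≈ s · (a · m) + y · (s · (a · l))
    split-minor = solve 5 (λ s a m y l →
      (s :* (a :* (m :+ y :* l))) := (s :* (a :* m) :+ y :* (s :* (a :* l)))) ≈-refl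
    term : ∀ j → laplace A j ≈ laplace B j + y · laplace C j
    term j with j Fin.≟ p
    ... | yes refl = begin
      laplace A j
        ≈⟨ *-congˡ (*-congʳ (at-p zero)) ⟩
      s · ((B zero j + y · C zero j) · L.det (minor A j))
        ≈⟨ split-entry s (B zero j) (C zero j) y (L.det (minor A j)) ⟩
      s · (B zero j · L.det (minor A j)) + y · (s · (C zero j · L.det (minor A j)))
        ≈⟨ +-cong (*-congˡ (*-congˡ (det-cong λ i k → A≈B (suc i) _ (Fin.punchInᵢ≢i j k))))
                  (*-congˡ (*-congˡ (*-congˡ (det-cong λ i k → A≈C (suc i) _ (Fin.punchInᵢ≢i j k))))) ⟩
      laplace B j + y · laplace C j ∎
      where s = (- 1#) ^ᴿ toℕ j
    ... | no j≢p = begin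
      laplace A j
        ≈⟨ *-congˡ (*-congˡ (det-linear p′ y at-p′ (λ i k k≢p′ → A≈B (suc i) _ (k≢p′ ∘ back k))
                                                   (λ i k k≢p′ → A≈C (suc i) _ (k≢p′ ∘ back k)))) ⟩
      s · (A zero j · (L.det (minor B j) + y · L.det (minor C j)))
        ≈⟨ split-minor s (A zero j) (L.det (minor B j)) y (L.det (minor C j)) ⟩
      s · (A zero j · L.det (minor B j)) + y · (s · (A zero j · L.det (minor C j)))
        ≈⟨ +-cong (*-congˡ (*-congʳ (A≈B zero j j≢p))) (*-congˡ (*-congˡ (*-congʳ (A≈C zero j j≢p)))) ⟩
      laplace B j + y · laplace C j ∎
      where
      s = (- 1#) ^ᴿ toℕ j
      p′ = punchOut j≢p
      p′-in : punchIn j p′ ≡ p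
      p′-in = Fin.punchIn-punchOut j≢p
      back : ∀ k → punchIn j k ≡ p → k ≡ p′
      back k e = Fin.punchIn-injective j k p′ (trans e (sym p′-in))
      at-p′ : ∀ i → minor A j i p′ ≈ minor B j i p′ + y · minor C j i p′
      at-p′ i = subst (λ q → A (suc i) q ≈ B (suc i) q + y · C (suc i) q) (sym p′-in) (at-p (suc i))

  ∑-cancel-adjacent : ∀ {n} (f : Vector Carrier (suc n)) q →
    (∀ j → j ≢ inject₁ q → j ≢ suc q → f j ≈ 0#) → f (inject₁ q) + f (suc q) ≈ 0# → ∑ f ≈ 0#
  ∑-cancel-adjacent {suc n} f zero others pair = begin
    f zero + (f (suc zero) + ∑ (λ j → f (suc (suc j))))
      ≈⟨ +-assoc _ _ _ ⟨
    f zero + f (suc zero) + ∑ (λ j → f (suc (suc j)))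
      ≈⟨ +-cong pair (≈-trans (sum-cong-≋ (λ j → others (suc (suc j)) (λ ()) (λ ())))
                              (sum-replicate-zero n)) ⟩
    0# + 0#
      ≈⟨ +-identityˡ 0# ⟩
    0# ∎
  ∑-cancel-adjacent {suc n} f (suc q) others pair = ≈-trans
    (+-cong (others zero (λ ()) (λ ()))
            (∑-cancel-adjacent (f ∘ suc) q
              (λ j j≢ j≢′ → others (suc j) (j≢ ∘ Fin.suc-injective) (j≢′ ∘ Fin.suc-injective)) pair))
    (+-identityˡ 0#)

  -- A third column lies to the left of both or to the right of both, so its deletion shifts both
  -- alike and keeps them adjacent.
  punchIn-adjacent : ∀ {n} (j : Fin (suc (suc n))) (q : Fin (suc n)) → j ≢ inject₁ q → j ≢ suc q →
    ∃[ q′ ] punchIn j (inject₁ q′) ≡ inject₁ q × punchIn j (suc q′) ≡ suc q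
  punchIn-adjacent zero    zero    j≢ _ = contradiction refl j≢
  punchIn-adjacent {suc n} zero (suc q) _ _ = q , refl , refl
  punchIn-adjacent (suc zero) zero _ j≢ = contradiction refl j≢
  punchIn-adjacent {suc n} (suc (suc j)) zero _ _ = zero , refl , refl
  punchIn-adjacent {suc n} (suc j) (suc q) j≢ j≢′ =
    let q′ , e , e′ = punchIn-adjacent j q (j≢ ∘ cong suc) (j≢′ ∘ cong suc)
    in suc q′ , cong suc e , cong suc e′

  -- The two maps differ only at `k = q`. Hence, when the two columns are equal, deleting either one
  -- gives the same minor.
  punchIn-inject₁-suc : ∀ {n} (q k : Fin n) →
    punchIn (inject₁ q) k ≡ punchIn (suc q) k ⊎
    punchIn (inject₁ q) k ≡ suc q × punchIn (suc q) k ≡ inject₁ q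
  punchIn-inject₁-suc zero    zero    = inj₂ (refl , refl)
  punchIn-inject₁-suc zero    (suc k) = inj₁ refl
  punchIn-inject₁-suc (suc q) zero    = inj₁ refl
  punchIn-inject₁-suc (suc q) (suc k) with punchIn-inject₁-suc q k
  ... | inj₁ e        = inj₁ (cong suc e)
  ... | inj₂ (e , e′) = inj₂ (cong suc e , cong suc e′)

  -- Minors at the other columns keep two equal adjacent columns and vanish by induction. The two
  -- remaining terms have equal entries and equal minors but opposite signs.
  det-adjacent-equal : ∀ {n} (q : Fin n) (A : Mat (suc n)) →
    (∀ i → A i (inject₁ q) ≈ A i (suc q)) → L.det A ≈ 0#
  det-adjacent-equal {suc n} q A equal = ∑-cancel-adjacent (laplace A) q others pair
    where
    others : ∀ j → j ≢ inject₁ q → j ≢ suc q → laplace A j ≈ 0#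
    others j j≢ j≢′ with punchIn-adjacent j q j≢ j≢′
    ... | q′ , e , e′ = ≈-trans
      (*-congˡ (≈-trans (*-congˡ (det-adjacent-equal q′ (minor A j) λ i →
        ≈-trans (reflexive (cong (A (suc i)) e))
          (≈-trans (equal (suc i)) (reflexive (cong (A (suc i)) (sym e′)))))) (zeroʳ _)))
      (zeroʳ _)
    minors : ∀ i k → minor A (inject₁ q) i k ≈ minor A (suc q) i k
    minors i k with punchIn-inject₁-suc q k
    ... | inj₁ e = reflexive (cong (A (suc i)) e)
    ... | inj₂ (e , e′) = ≈-trans (reflexive (cong (A (suc i)) e))
            (≈-trans (≈-sym (equal (suc i))) (reflexive (cong (A (suc i)) (sym e′))))
    t = (- 1#) ^ᴿ toℕ q · (A zero (suc q) · L.det (minor A (suc q)))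
    pair : laplace A (inject₁ q) + laplace A (suc q) ≈ 0#
    pair = begin
      laplace A (inject₁ q) + laplace A (suc q)
        ≈⟨ +-cong (*-cong (reflexive (cong ((- 1#) ^ᴿ_) (Fin.toℕ-inject₁ q)))
                          (*-cong (equal zero) (det-cong minors)))
                  (≈-trans (*-assoc _ _ _) (-1*x≈-x t)) ⟩
      t + - t
        ≈⟨ -‿inverseʳ t ⟩
      0# ∎

  -- With x and y the columns suc q and suc (suc q) and y also column 0, moving the repetition
  -- one step to the left uses det (… x y …) = det (… x (x+y) …) = det (… (x+y) (x+y) …).
  det-repeated-column : ∀ {n} (q : Fin n) (A : Mat (suc n)) →
    (∀ i → A i zero ≈ A i (suc q)) → L.det A ≈ 0#
  det-repeated-column {suc n} = <-weakInduction Vanishes (det-adjacent-equal zero) step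
    where
    -- The matrix is quantified inside, because the step uses the induction hypothesis for the
    -- modified matrix `D`.
    Vanishes : Fin (suc n) → Set
    Vanishes q = ∀ A → (∀ i → A i zero ≈ A i (suc q)) → L.det A ≈ 0#
    step : ∀ q → Vanishes (inject₁ q) → Vanishes (suc q)
    step q vanishes A equal = begin
      L.det A                          ≈⟨ +-identityʳ _ ⟨
      L.det A + 0#                     ≈⟨ +-congˡ (≈-trans (*-identityˡ _) detA₁≈0) ⟨
      L.det A + 1# · L.det A₁          ≈⟨ det-linear p′ 1# at-p′ B≈A B≈A₁ ⟨
      L.det B                          ≈⟨ +-identityʳ _ ⟨
      L.det B + 0#                     ≈⟨ +-congˡ (≈-trans (*-identityˡ _) detD≈0) ⟨
      L.det B + 1# · L.det D           ≈⟨ det-linear p 1# at-p (≔-off B p x+y) C≈D ⟨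
      L.det C                          ≈⟨ det-adjacent-equal (suc q) C C-equal ⟩
      0#                               ∎
      where
      p  = suc (inject₁ q)
      p′ = suc (suc q)
      p≢p′ : p ≢ p′
      p≢p′ e = Fin.<⇒≢ (Fin.≤̄⇒inject₁< Fin.≤-refl) (Fin.suc-injective e)
      x y x+y : Vector Carrier (suc (suc n))
      x i = A i p
      y i = A i p′
      x+y i = x i + y i
      A₁ = A [ p′ ≔ x ]
      B  = A [ p′ ≔ x+y ]
      C  = B [ p ≔ x+y ]
      D  = B [ p ≔ y ]
      detA₁≈0 : L.det A₁ ≈ 0#
      detA₁≈0 = det-adjacent-equal (suc q) A₁ λ i →
        ≈-trans (≔-off A p′ x i p p≢p′) (≈-sym (≔-at A p′ x i))
      detD≈0 : L.det D ≈ 0#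
      detD≈0 = vanishes D λ i → ≈-trans (≔-off B p y i zero (λ ()))
        (≈-trans (≔-off A p′ x+y i zero (λ ())) (≈-trans (equal i) (≈-sym (≔-at B p y i))))
      at-p′ : ∀ i → B i p′ ≈ A i p′ + 1# · A₁ i p′
      at-p′ i = begin
        B i p′                   ≈⟨ ≔-at A p′ x+y i ⟩
        A i p + A i p′           ≈⟨ +-comm _ _ ⟩
        A i p′ + A i p           ≈⟨ +-congˡ (≈-trans (*-identityˡ _) (≔-at A p′ x i)) ⟨
        A i p′ + 1# · A₁ i p′    ∎
      B≈A : ∀ i j → j ≢ p′ → B i j ≈ A i j
      B≈A = ≔-off A p′ x+y
      B≈A₁ : ∀ i j → j ≢ p′ → B i j ≈ A₁ i j
      B≈A₁ i j j≢ = ≈-trans (≔-off A p′ x+y i j j≢) (≈-sym (≔-off A p′ x i j j≢))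
      at-p : ∀ i → C i p ≈ B i p + 1# · D i p
      at-p i = begin
        C i p                    ≈⟨ ≔-at B p x+y i ⟩
        A i p + A i p′           ≈⟨ +-cong (B≈A i p p≢p′) (≈-trans (*-identityˡ _) (≔-at B p y i)) ⟨
        B i p + 1# · D i p       ∎
      C≈D : ∀ i j → j ≢ p → C i j ≈ D i j
      C≈D i j j≢ = ≈-trans (≔-off B p x+y i j j≢) (≈-sym (≔-off B p y i j j≢))
      C-equal : ∀ i → C i p ≈ C i p′
      C-equal i = begin
        C i p      ≈⟨ ≔-at B p x+y i ⟩
        x+y i      ≈⟨ ≔-at A p′ x+y i ⟨
        B i p′     ≈⟨ ≔-off B p x+y i p′ (p≢p′ ∘ sym) ⟨
        C i p′     ∎

  -- Elimination of the first row by column operations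

  shear : ∀ {n} → Mat (suc n) → Vector Carrier n → Mat (suc n)
  shear A c i zero    = A i zero
  shear A c i (suc j) = A i (suc j) + c j · A i zero

  -- Turns invariance under clearing one coordinate into invariance under clearing all: after the
  -- first coordinate is cleared, the induction continues with `G` restricted to vectors that start
  -- with `0#`. The congruence hypothesis bridges vectors that agree only pointwise.
  zero-coordinates : ∀ {n} (G : Vector Carrier n → Carrier) →
    (∀ {c c′} → (∀ j → c j ≈ c′ j) → G c ≈ G c′) →
    (∀ c j → G c ≈ G (updateAt c j (λ _ → 0#))) → ∀ c → G c ≈ G (λ _ → 0#)
  zero-coordinates {zero}  G G-cong G-zero c = G-cong (λ ())
  zero-coordinates {suc n} G G-cong G-zero c = begin
    G c                     ≈⟨ G-zero c zero ⟩
    G (updateAt c zero _)   ≈⟨ G-cong (λ { zero → ≈-refl ; (suc j) → ≈-refl }) ⟩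
    G (0# ∷ (c ∘ suc))      ≈⟨ zero-coordinates (λ d → G (0# ∷ d))
                                 (λ d≈d′ → G-cong λ { zero → ≈-refl ; (suc j) → d≈d′ j })
                                 (λ d j → ≈-trans (G-zero (0# ∷ d) (suc j))
                                   (G-cong λ { zero → ≈-refl ; (suc k) → ≈-refl })) (c ∘ suc) ⟩
    G (0# ∷ (λ _ → 0#))     ≈⟨ G-cong (λ { zero → ≈-refl ; (suc j) → ≈-refl }) ⟩
    G (λ _ → 0#)            ∎

  -- By linearity in column `suc j`, clearing the multiplier `c j` changes the determinant by `c j`
  -- times that of a matrix in which column 0 occurs twice.
  det-shear : ∀ {n} (A : Mat (suc n)) c → L.det (shear A c) ≈ L.det A
  det-shear {n} A c = ≈-trans
    (zero-coordinates (λ d → L.det (shear A d)) (λ d≈d′ → det-cong (shear-cong d≈d′)) clear c)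
    (det-cong shear-0)
    where
    shear-cong : ∀ {c c′} → (∀ j → c j ≈ c′ j) → ∀ i j → shear A c i j ≈ shear A c′ i j
    shear-cong c≈c′ i zero    = ≈-refl
    shear-cong c≈c′ i (suc j) = +-congˡ (*-congʳ (c≈c′ j))
    shear-0 : ∀ i j → shear A (λ _ → 0#) i j ≈ A i j
    shear-0 i zero    = ≈-refl
    shear-0 i (suc j) = ≈-trans (+-congˡ (zeroˡ _)) (+-identityʳ _)
    clear : ∀ c j → L.det (shear A c) ≈ L.det (shear A (updateAt c j (λ _ → 0#)))
    clear c j = begin
      L.det (shear A c)
        ≈⟨ det-linear (suc j) (c j) at-j off-j off-j′ ⟩
      L.det B + c j · L.det C
        ≈⟨ +-congˡ (≈-trans (*-congˡ (det-repeated-column j C λ i →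
             ≈-trans (≔-off B (suc j) col₀ i zero (λ ())) (≈-sym (≔-at B (suc j) col₀ i)))) (zeroʳ _)) ⟩
      L.det B + 0#
        ≈⟨ +-identityʳ _ ⟩
      L.det B ∎
      where
      c′ = updateAt c j (λ _ → 0#)
      B  = shear A c′
      col₀ : Vector Carrier (suc n)
      col₀ i = A i zero
      C  = B [ suc j ≔ col₀ ]
      at-j : ∀ i → shear A c i (suc j) ≈ B i (suc j) + c j · C i (suc j)
      at-j i = +-cong
        (≈-sym (≈-trans (+-congˡ (≈-trans (*-congʳ (reflexive (Vector.updateAt-updates j c))) (zeroˡ _)))
                        (+-identityʳ _)))
        (*-congˡ (≈-sym (≔-at B (suc j) col₀ i)))
      off-j : ∀ i k → k ≢ suc j → shear A c i k ≈ B i k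
      off-j i zero    _    = ≈-refl
      off-j i (suc k) k≢sj =
        +-congˡ (*-congʳ (reflexive (sym (Vector.updateAt-minimal k j c (k≢sj ∘ cong suc)))))
      off-j′ : ∀ i k → k ≢ suc j → shear A c i k ≈ C i k
      off-j′ i k k≢sj = ≈-trans (off-j i k k≢sj) (≈-sym (≔-off B (suc j) col₀ i k k≢sj))

  -- For `c j` equal to minus `A zero (suc j)` divided by the corner entry, this is the usual Schur
  -- complement. Keeping `c` as a parameter avoids division, so that the definition makes sense over
  -- any commutative ring.
  schurComplement : ∀ {n} → Mat (suc n) → Vector Carrier n → Mat n
  schurComplement A c i j = A (suc i) (suc j) + c j · A (suc i) zero

  -- The hypothesis says that the shear clears the first row outside the corner, so only one term of
  -- the Laplace expansion survives.
  det-schurComplement : ∀ {n} (A : Mat (suc n)) c →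
    (∀ j → A zero (suc j) + c j · A zero zero ≈ 0#) →
    L.det A ≈ A zero zero · L.det (schurComplement A c)
  det-schurComplement {n} A c cleared = begin
    L.det A
      ≈⟨ det-shear A c ⟨
    L.det (shear A c)
      ≈⟨ +-cong (*-identityˡ _) (≈-trans (sum-cong-≋ λ j →
           ≈-trans (*-congˡ (≈-trans (*-congʳ (cleared j)) (zeroˡ _))) (zeroʳ _)) (sum-replicate-zero n)) ⟩
    A zero zero · L.det (schurComplement A c) + 0#
      ≈⟨ +-identityʳ _ ⟩
    A zero zero · L.det (schurComplement A c) ∎

-- Diagonally dominant matrices

module ℚ-LinearAlgebra = LinearAlgebra ℚ.+-*-commutativeRing
module ℚ-Determinant = Determinant ℚ.+-*-commutativeRing
open ℚ-Determinant using (schurComplement; det-schurComplement)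
open Algebra.Properties.Semiring.Sum (CommutativeRing.semiring ℚ.+-*-commutativeRing)
  using (∑-distrib-+; *-distribˡ-sum; sum-cong-≗) renaming (sum to ∑)
open import Algebra.Definitions.RawSemiring
  (CommutativeSemiring.rawSemiring (CommutativeRing.commutativeSemiring ℚ.+-*-commutativeRing))
  using () renaming (_^_ to _^ℚ_; product to ∏)

InUnitInterval : ℚ → Set
InUnitInterval p = ℚ.- 1ℚ ℚ.≤ p × p ℚ.≤ 1ℚ

-- Aᵢᵢ - Σ_{j ≠ i} |Aᵢⱼ| is the minimum of Σⱼ Aᵢⱼ vⱼ over the vectors v in [-1, 1]ⁿ with
-- vᵢ = 1; in this form dominance passes to Schur complements without estimates.
Dominant : ∀ {n} → ℚ → Matrix ℚ n → Set
Dominant {n} δ A = ∀ i (v : Vector ℚ n) → (∀ j → InUnitInterval (v j)) → v i ≡ 1ℚ →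
                   δ ℚ.≤ ∑ (λ j → A i j ℚ.* v j)

∑-zero : ∀ {n} (f : Vector ℚ n) → (∀ j → f j ≡ 0ℚ) → ∑ f ≡ 0ℚ
∑-zero {zero}  f f≡0 = refl
∑-zero {suc n} f f≡0 = cong₂ ℚ._+_ (f≡0 zero) (∑-zero (λ j → f (suc j)) (λ j → f≡0 (suc j)))

0≤1 : 0ℚ ℚ.≤ 1ℚ
0≤1 = ℚ.nonNegative⁻¹ 1ℚ
-1≤0 : ℚ.- 1ℚ ℚ.≤ 0ℚ
-1≤0 = ℚ.neg-antimono-≤ 0≤1

1∈ : InUnitInterval 1ℚ
1∈ = ℚ.≤-trans -1≤0 0≤1 , ℚ.≤-refl

∷-inUnitInterval : ∀ {n p} {v : Vector ℚ n} → InUnitInterval p → (∀ j → InUnitInterval (v j)) →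
                   ∀ j → InUnitInterval ((p ∷ v) j)
∷-inUnitInterval p∈ v∈ zero    = p∈
∷-inUnitInterval p∈ v∈ (suc j) = v∈ j

0≤p-q⇒q≤p : ∀ {p q} → 0ℚ ℚ.≤ p ℚ.- q → q ℚ.≤ p
0≤p-q⇒q≤p {p} {q} 0≤p-q = subst (q ℚ.≤_) (restore p q)
  (subst (ℚ._≤ q ℚ.+ (p ℚ.- q)) (ℚ.+-identityʳ q) (ℚ.+-monoʳ-≤ q 0≤p-q))
  where
  open +-*-Solver
  restore : ∀ p q → q ℚ.+ (p ℚ.- q) ≡ p
  restore = solve 2 (λ p q → q :+ (p :- q) := p) refl

-- Test vectors range over the whole cube and not only over signs, so the first unit vector is
-- admissible and isolates the corner.
pivot-dominant : ∀ {n δ} {A : Matrix ℚ (suc n)} → Dominant δ A → δ ℚ.≤ A zero zero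
pivot-dominant {n} {δ} {A} dom = subst (δ ℚ.≤_) only-pivot
  (dom zero (1ℚ ∷ (λ _ → 0ℚ))
    (∷-inUnitInterval 1∈ λ _ → -1≤0 , 0≤1) refl)
  where
  only-pivot : A zero zero ℚ.* 1ℚ ℚ.+ ∑ (λ j → A zero (suc j) ℚ.* 0ℚ) ≡ A zero zero
  only-pivot = trans
    (cong₂ ℚ._+_ (ℚ.*-identityʳ (A zero zero)) (∑-zero _ λ j → ℚ.*-zeroʳ (A zero (suc j))))
    (ℚ.+-identityʳ _)

module _ {n} (δ : ℚ) (0<δ : 0ℚ ℚ.< δ) (A : Matrix ℚ (suc n)) (dom : Dominant δ A)
         (c : Vector ℚ n) (cleared : ∀ j → A zero (suc j) ℚ.+ c j ℚ.* A zero zero ≡ 0ℚ) where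
  private
    a = A zero zero
    0<a : 0ℚ ℚ.< a
    0<a = ℚ.<-≤-trans 0<δ (pivot-dominant {A = A} dom)
    instance
      a-pos : ℚ.Positive a
      a-pos = ℚ.positive 0<a

  row-sum-shift : ∀ (v : Vector ℚ n) → ∑ (λ j → A zero (suc j) ℚ.* v j) ≡ ℚ.- (a ℚ.* ∑ (λ j → c j ℚ.* v j))
  row-sum-shift v = trans (sum-cong-≗ term)
    (trans (sym (*-distribˡ-sum (ℚ.- a) (λ j → c j ℚ.* v j))) (sym (ℚ.neg-distribˡ-* a _)))
    where
    open +-*-Solver
    rearrange : ∀ b c a v → b ℚ.* v ≡ (b ℚ.+ c ℚ.* a) ℚ.* v ℚ.+ (ℚ.- a) ℚ.* (c ℚ.* v)
    rearrange = solve 4 (λ b c a v → b :* v := (b :+ c :* a) :* v :+ (:- a) :* (c :* v)) refl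
    term : ∀ j → A zero (suc j) ℚ.* v j ≡ (ℚ.- a) ℚ.* (c j ℚ.* v j)
    term j = trans (rearrange (A zero (suc j)) (c j) a (v j))
      (trans (cong (λ z → z ℚ.* v j ℚ.+ (ℚ.- a) ℚ.* (c j ℚ.* v j)) (cleared j))
        (trans (cong (ℚ._+ (ℚ.- a) ℚ.* (c j ℚ.* v j)) (ℚ.*-zeroˡ (v j))) (ℚ.+-identityˡ _)))

  -- Write w for the sum. Row zero tested on `1ℚ ∷ v` gives `δ` ≤ a - a w with a positive pivot a,
  -- hence w ≤ 1.
  combination≤1 : ∀ (v : Vector ℚ n) → (∀ j → InUnitInterval (v j)) → ∑ (λ j → c j ℚ.* v j) ℚ.≤ 1ℚ
  combination≤1 v v∈ = ℚ.*-cancelˡ-≤-pos a (0≤p-q⇒q≤p (begin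
    0ℚ                                                      ≤⟨ ℚ.<⇒≤ 0<δ ⟩
    δ                                                       ≤⟨ dom zero (1ℚ ∷ v) (∷-inUnitInterval 1∈ v∈) refl ⟩
    a ℚ.* 1ℚ ℚ.+ ∑ (λ j → A zero (suc j) ℚ.* v j)           ≡⟨ cong (a ℚ.* 1ℚ ℚ.+_) (row-sum-shift v) ⟩
    a ℚ.* 1ℚ ℚ.- a ℚ.* ∑ (λ j → c j ℚ.* v j)                ∎))
    where open ℚ.≤-Reasoning

  -- The cube is symmetric, so the lower bound is the upper bound for the negated vector.
  combination∈ : ∀ (v : Vector ℚ n) → (∀ j → InUnitInterval (v j)) → InUnitInterval (∑ (λ j → c j ℚ.* v j))
  combination∈ v v∈ = subst (ℚ.- 1ℚ ℚ.≤_) negated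
      (ℚ.neg-antimono-≤ (combination≤1 (λ j → ℚ.- v j) λ j →
        ℚ.neg-antimono-≤ (proj₂ (v∈ j)) , ℚ.neg-antimono-≤ (proj₁ (v∈ j)))) ,
    combination≤1 v v∈
    where
    open +-*-Solver
    pull : ∀ c v → c ℚ.* (ℚ.- v) ≡ (ℚ.- 1ℚ) ℚ.* (c ℚ.* v)
    pull = solve 2 (λ c v → c :* (:- v) := (:- con 1ℚ) :* (c :* v)) refl
    unpull : ∀ w → ℚ.- ((ℚ.- 1ℚ) ℚ.* w) ≡ w
    unpull = solve 1 (λ w → :- ((:- con 1ℚ) :* w) := w) refl
    negated : ℚ.- ∑ (λ j → c j ℚ.* (ℚ.- v j)) ≡ ∑ (λ j → c j ℚ.* v j)
    negated = trans (cong ℚ.-_ (trans (sum-cong-≗ λ j → pull (c j) (v j))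
        (sym (*-distribˡ-sum (ℚ.- 1ℚ) (λ j → c j ℚ.* v j)))))
      (unpull (∑ (λ j → c j ℚ.* v j)))

  -- Testing row `i` of the complement on `v` is the same as testing row `suc i` of `A` on `w ∷ v`,
  -- where `w` is the combination just shown to lie in the unit interval. The margin `δ` therefore
  -- survives undiminished.
  schurComplement-dominant : Dominant δ (schurComplement A c)
  schurComplement-dominant i v v∈ vᵢ≡1 = subst (δ ℚ.≤_) (sym row)
    (dom (suc i) (w ∷ v) (∷-inUnitInterval (combination∈ v v∈) v∈) vᵢ≡1)
    where
    open +-*-Solver
    w = ∑ (λ j → c j ℚ.* v j)
    b = A (suc i) zero
    distribute : ∀ x c b v → (x ℚ.+ c ℚ.* b) ℚ.* v ≡ b ℚ.* (c ℚ.* v) ℚ.+ x ℚ.* v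
    distribute = solve 4 (λ x c b v → (x :+ c :* b) :* v := b :* (c :* v) :+ x :* v) refl
    row : ∑ (λ j → schurComplement A c i j ℚ.* v j) ≡
          b ℚ.* w ℚ.+ ∑ (λ j → A (suc i) (suc j) ℚ.* v j)
    row = trans (sum-cong-≗ λ j → distribute (A (suc i) (suc j)) (c j) b (v j))
      (trans (∑-distrib-+ (λ j → b ℚ.* (c j ℚ.* v j)) (λ j → A (suc i) (suc j) ℚ.* v j))
        (cong (ℚ._+ ∑ (λ j → A (suc i) (suc j) ℚ.* v j))
          (sym (*-distribˡ-sum b (λ j → c j ℚ.* v j)))))

^-pos : ∀ {δ} → 0ℚ ℚ.< δ → ∀ n → 0ℚ ℚ.< δ ^ℚ n
^-pos 0<δ zero = ℚ.positive⁻¹ 1ℚ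
^-pos {δ} 0<δ (suc n) = ℚ.positive⁻¹ (δ ℚ.* δ ^ℚ n)
  {{ℚ.pos*pos⇒pos δ {{ℚ.positive 0<δ}} (δ ^ℚ n) {{ℚ.positive (^-pos 0<δ n)}}}}

-- Gaussian elimination: the determinant is the product of the pivots, and each pivot is at least
-- `δ` because the margin is preserved from one Schur complement to the next.
dominant⇒δⁿ≤det : ∀ {n δ} → 0ℚ ℚ.< δ → (A : Matrix ℚ n) → Dominant δ A →
                  δ ^ℚ n ℚ.≤ ℚ-LinearAlgebra.det A
dominant⇒δⁿ≤det {zero}      0<δ A dom = ℚ.≤-refl
dominant⇒δⁿ≤det {suc n} {δ} 0<δ A dom = begin
  δ ℚ.* δ ^ℚ n
    ≤⟨ ℚ.*-monoʳ-≤-nonNeg (δ ^ℚ n) {{ℚ.nonNegative (ℚ.<⇒≤ (^-pos 0<δ n))}} δ≤a ⟩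
  a ℚ.* δ ^ℚ n
    ≤⟨ ℚ.*-monoˡ-≤-nonNeg a {{ℚ.nonNegative (ℚ.<⇒≤ 0<a)}}
         (dominant⇒δⁿ≤det 0<δ (schurComplement A c) (schurComplement-dominant δ 0<δ A dom c cleared)) ⟩
  a ℚ.* ℚ-LinearAlgebra.det (schurComplement A c)
    ≡⟨ det-schurComplement A c cleared ⟨
  ℚ-LinearAlgebra.det A ∎
  where
  open ℚ.≤-Reasoning
  a = A zero zero
  δ≤a : δ ℚ.≤ a
  δ≤a = pivot-dominant {A = A} dom
  0<a : 0ℚ ℚ.< a
  0<a = ℚ.<-≤-trans 0<δ δ≤a
  instance
    a-nonZero : ℚ.NonZero a
    a-nonZero = ℚ.pos⇒nonZero a {{ℚ.positive 0<a}}
  c : Vector ℚ n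
  c j = ℚ.- (A zero (suc j) ℚ.* ℚ.1/ a)
  open +-*-Solver
  regroup : ∀ b i a → b ℚ.+ (ℚ.- (b ℚ.* i)) ℚ.* a ≡ b ℚ.* (1ℚ ℚ.- i ℚ.* a)
  regroup = solve 3 (λ b i a → b :+ (:- (b :* i)) :* a := b :* (con 1ℚ :- i :* a)) refl
  cleared : ∀ j → A zero (suc j) ℚ.+ c j ℚ.* a ≡ 0ℚ
  cleared j = trans (regroup (A zero (suc j)) (ℚ.1/ a) a)
    (trans (cong (λ z → A zero (suc j) ℚ.* (1ℚ ℚ.- z)) (ℚ.*-inverseˡ a))
      (ℚ.*-zeroʳ (A zero (suc j))))

-- Edge counts

open Algebra.Properties.Semiring.Sum ℕ.+-*-semiring using () renaming (sum to ∑ℕ)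

count-complement : ∀ {a} {A : Set a} {P Q : Pred A 0ℓ} (P? : Decidable P) (Q? : Decidable Q) →
  (∀ {x} → P x → Q x) → ∀ {n} (xs : Vec A n) →
  count P? xs ℕ.+ count (λ x → Q? x ×-dec ¬? (P? x)) xs ≡ count Q? xs
count-complement P? Q? P⊆Q Vec.[] = refl
count-complement P? Q? P⊆Q (x Vec.∷ xs) with P? x | Q? x
... | yes p | yes q = cong suc (count-complement P? Q? P⊆Q xs)
... | yes p | no ¬q = contradiction (P⊆Q p) ¬q
... | no ¬p | yes q = trans (ℕ.+-suc _ _) (cong suc (count-complement P? Q? P⊆Q xs))
... | no ¬p | no ¬q = count-complement P? Q? P⊆Q xs

-- By exclusivity the later predicates still lie inside `Q` after the elements of the first one are
-- removed from it.
∑-count-exclusive : ∀ {k a} {A : Set a} {P : Fin k → Pred A 0ℓ} {Q : Pred A 0ℓ}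
  (P? : ∀ j → Decidable (P j)) (Q? : Decidable Q) →
  (∀ {j x} → P j x → Q x) → (∀ {i j x} → P i x → P j x → i ≡ j) →
  ∀ {n} (xs : Vec A n) → ∑ℕ (λ j → count (P? j) xs) ≤ count Q? xs
∑-count-exclusive {zero}  P? Q? P⊆Q exclusive xs = ℕ.z≤n
∑-count-exclusive {suc k} {P = P} P? Q? P⊆Q exclusive xs = begin
  count (P? zero) xs ℕ.+ ∑ℕ (λ j → count (P? (suc j)) xs)
    ≤⟨ ℕ.+-monoʳ-≤ (count (P? zero) xs)
         (∑-count-exclusive (P? ∘ suc) (λ x → Q? x ×-dec ¬? (P? zero x))
           (λ p → P⊆Q p , λ p₀ → Fin.0≢1+n (exclusive p₀ p))
           (λ p p′ → Fin.suc-injective (exclusive p p′)) xs) ⟩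
  count (P? zero) xs ℕ.+ count (λ x → Q? x ×-dec ¬? (P? zero x)) xs
    ≡⟨ count-complement (P? zero) Q? P⊆Q xs ⟩
  count Q? xs ∎
  where open ℕ.≤-Reasoning

-- An edge at `i` determines its other end, so no edge is counted for two values of `j`. The term
-- `j = i` counts the loops, each of which contributes 1 to the degree as well.
∑-multiplicity≤degree : ∀ G i → ∑ℕ (multiplicity G i) ≤ degree G i
∑-multiplicity≤degree G i =
  ∑-count-exclusive (joins? G i) (attached? G i) attached exclusive (allFin (Quiver.m G))
  where
  attached : ∀ {j e} → Joins G e i j → Attached G e i
  attached (inj₁ p) = inj₁ (cong proj₁ p)
  attached (inj₂ p) = inj₂ (cong proj₂ p)
  exclusive : ∀ {j k e} → Joins G e i j → Joins G e i k → j ≡ k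
  exclusive (inj₁ p) (inj₁ q) = cong proj₂ (trans (sym p) q)
  exclusive (inj₂ p) (inj₂ q) = cong proj₁ (trans (sym p) q)
  -- With opposite orientations the edge must be a loop at `i`, so both ends are `i`.
  exclusive (inj₁ p) (inj₂ q) =
    let r = trans (sym p) q in trans (cong proj₂ r) (cong proj₁ r)
  exclusive (inj₂ p) (inj₁ q) =
    let r = trans (sym p) q in trans (cong proj₁ r) (cong proj₂ r)

≤-maximum : ∀ {n} (f : Vector ℕ n) i → f i ≤ foldr ℕ._⊔_ 0 f
≤-maximum f zero    = ℕ.m≤m⊔n _ _
≤-maximum f (suc i) = ℕ.≤-trans (≤-maximum (f ∘ suc) i) (ℕ.m≤n⊔m (f zero) _)

-- Labels are constant on components and all of them occur, so `k` is at most the number of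
-- components.
record ComponentLabelling {n m} (ends : Fin m → Fin n × Fin n) (k : ℕ) : Set where
  field
    label      : Fin n → Fin k
    surjective : ∀ l → ∃[ v ] label v ≡ l
    along-edge : ∀ e → label (proj₁ (ends e)) ≡ label (proj₂ (ends e))

-- Adding an edge merges at most two components.
componentLabelling : ∀ {n} m (ends : Fin m → Fin n × Fin n) →
                     ∃[ k ] n ≤ m ℕ.+ k × ComponentLabelling ends k
componentLabelling {n} zero ends = n , ℕ.≤-refl , record
  { label = id ; surjective = λ l → l , refl ; along-edge = λ () }
componentLabelling {n} (suc m) ends with componentLabelling m (ends ∘ suc)
... | zero , n≤m+k , L =
  contradiction (ComponentLabelling.label L (proj₁ (ends zero))) λ ()
... | suc k , n≤m+k , L with ℓ₁ Fin.≟ ℓ₂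
  where
  open ComponentLabelling L
  ℓ₁ = label (proj₁ (ends zero))
  ℓ₂ = label (proj₂ (ends zero))
...   | yes ℓ₁≡ℓ₂ = suc k , ℕ.m≤n⇒m≤1+n n≤m+k , record
  { label = label ; surjective = surjective
  ; along-edge = λ { zero → ℓ₁≡ℓ₂ ; (suc e) → along-edge e } }
  where open ComponentLabelling L
...   | no ℓ₁≢ℓ₂ = k , subst (n ≤_) (ℕ.+-suc m k) n≤m+k , record
  { label = merge ∘ label
  ; surjective = λ l → let v , e = surjective (punchIn ℓ₁ l) in v , trans (cong merge e) (merge-punchIn l)
  ; along-edge = λ { zero → merged ; (suc e) → cong merge (along-edge e) } }
  where
  open ComponentLabelling L
  ℓ₁ = label (proj₁ (ends zero))
  ℓ₂ = label (proj₂ (ends zero))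
  -- The label `ℓ₁` is deleted, and its vertices receive the new name of `ℓ₂`.
  merge : Fin (suc k) → Fin k
  merge l with ℓ₁ Fin.≟ l
  ... | yes _   = punchOut ℓ₁≢ℓ₂
  ... | no ℓ₁≢l = punchOut ℓ₁≢l
  merge-punchIn : ∀ l → merge (punchIn ℓ₁ l) ≡ l
  merge-punchIn l with ℓ₁ Fin.≟ punchIn ℓ₁ l
  ... | yes e = contradiction (sym e) (Fin.punchInᵢ≢i ℓ₁ l)
  ... | no _  = trans (Fin.punchOut-cong ℓ₁ refl) (Fin.punchOut-punchIn ℓ₁)
  merged : merge ℓ₁ ≡ merge ℓ₂
  merged with ℓ₁ Fin.≟ ℓ₁ | ℓ₁ Fin.≟ ℓ₂
  ... | yes _    | yes e = contradiction e ℓ₁≢ℓ₂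
  ... | yes _    | no _  = Fin.punchOut-cong ℓ₁ refl
  ... | no ℓ₁≢ℓ₁ | _     = contradiction refl ℓ₁≢ℓ₁

connected⇒n≤m+1 : ∀ G → Connected G → Quiver.n G ≤ Quiver.m G ℕ.+ 1
connected⇒n≤m+1 G connected with componentLabelling (Quiver.m G) (Quiver.ends G)
... | k , n≤m+k , L = ℕ.≤-trans n≤m+k (ℕ.+-monoʳ-≤ (Quiver.m G) (k≤1 k L))
  where
  k≤1 : ∀ k → ComponentLabelling (Quiver.ends G) k → k ≤ 1
  k≤1 zero          L = ℕ.z≤n
  k≤1 (suc zero)    L = ℕ.≤-refl
  -- A path between vertices with the labels 0 and 1 would make these labels equal.
  k≤1 (suc (suc k)) L = contradiction 0≡1 λ ()
    where
    open ComponentLabelling L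
    along : ∀ {u v} → Star (λ u v → ∃[ e ] Joins G e u v) u v → label u ≡ label v
    along Star.ε = refl
    along ((e , inj₁ p) ◅ path) = trans
      (trans (sym (cong (label ∘ proj₁) p)) (trans (along-edge e) (cong (label ∘ proj₂) p))) (along path)
    along ((e , inj₂ p) ◅ path) = trans
      (trans (sym (cong (label ∘ proj₂) p)) (trans (sym (along-edge e)) (cong (label ∘ proj₁) p))) (along path)
    0≡1 : _≡_ {A = Fin (suc (suc k))} zero (suc zero)
    0≡1 = let u , eu = surjective zero ; v , ev = surjective (suc zero)
          in trans (sym eu) (trans (along (connected u v)) ev)

-- Arithmetic of the bound

2ab≤a²+b²-ordered : ∀ {a b} → a ≤ b → 2 * (a * b) ≤ a * a ℕ.+ b * b
-- Writing b = a + c, the two sides differ by c²; the ordering makes c a natural number.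
2ab≤a²+b²-ordered {a} {b} a≤b = subst (λ b → 2 * (a * b) ≤ a * a ℕ.+ b * b) (ℕ.m+[n∸m]≡n a≤b)
  (ℕ.m+n≤o⇒m≤o _ (ℕ.≤-reflexive (square a (b ℕ.∸ a))))
  where
  open ℕ-Solver
  square : ∀ a c → 2 * (a * (a ℕ.+ c)) ℕ.+ c * c ≡ a * a ℕ.+ (a ℕ.+ c) * (a ℕ.+ c)
  square = solve 2 (λ a c → con 2 :* (a :* (a :+ c)) :+ c :* c := a :* a :+ (a :+ c) :* (a :+ c)) refl

2ab≤a²+b² : ∀ a b → 2 * (a * b) ≤ a * a ℕ.+ b * b
2ab≤a²+b² a b with ℕ.≤-total a b
... | inj₁ a≤b = 2ab≤a²+b²-ordered a≤b
... | inj₂ b≤a = subst₂ _≤_ (cong (2 *_) (ℕ.*-comm b a)) (ℕ.+-comm (b * b) (a * a)) (2ab≤a²+b²-ordered b≤a)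

-- Truncated subtraction of `m` from the left side leaves a number to compare with the halved term
-- alone. Since halving is monotone, it suffices to compare the doubled numbers, which removes the
-- division.
brouwerBound-arithmetic : ∀ m r n d k → 4 * d ^ 2 ≤ n → n ≤ m ℕ.+ 1 →
  k * (2 * d) ≤ m ℕ.+ r ℕ.+ (k * (k ℕ.+ 1)) ℕ./ 2
-- Separate because `m` may be 0 here, and then m + 1 ≤ 2m fails.
brouwerBound-arithmetic m r n zero k _ _ = subst (_≤ m ℕ.+ r ℕ.+ (k * (k ℕ.+ 1)) ℕ./ 2) (sym (ℕ.*-zeroʳ k)) ℕ.z≤n
brouwerBound-arithmetic m r n d@(suc _) k 4d²≤n n≤m+1 = begin
  k * (2 * d)                                ≤⟨ ℕ.m≤n+m∸n (k * (2 * d)) m ⟩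
  m ℕ.+ (k * (2 * d) ℕ.∸ m)                  ≡⟨ cong (m ℕ.+_) (m*n/n≡m (k * (2 * d) ℕ.∸ m) 2) ⟨
  m ℕ.+ (k * (2 * d) ℕ.∸ m) * 2 ℕ./ 2        ≤⟨ ℕ.+-mono-≤ (ℕ.m≤m+n m r) (/-monoˡ-≤ 2 doubled) ⟩
  m ℕ.+ r ℕ.+ (k * (k ℕ.+ 1)) ℕ./ 2          ∎
  where
  open ℕ.≤-Reasoning
  4d²≤m+1 : 4 * d ^ 2 ≤ m ℕ.+ 1
  4d²≤m+1 = ℕ.≤-trans 4d²≤n n≤m+1
  1≤m : 1 ≤ m
  1≤m = ℕ.+-cancelʳ-≤ 1 1 m (begin
    2            ≤⟨ ℕ.*-mono-≤ {2} {4} {1} {d ^ 2} (ℕ.s≤s (ℕ.s≤s ℕ.z≤n)) (ℕ.m^n>0 d 2) ⟩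
    4 * d ^ 2    ≤⟨ 4d²≤m+1 ⟩
    m ℕ.+ 1      ∎)
  [2d]² : 2 * d * (2 * d) ≡ 4 * d ^ 2
  [2d]² = expand d
    where
    open ℕ-Solver
    expand : ∀ d → 2 * d * (2 * d) ≡ 4 * d ^ 2
    expand = solve 1 (λ d → con 2 :* d :* (con 2 :* d) := con 4 :* d :^ 2) refl
  k²≤k[k+1] : k * k ℕ.≤ k * (k ℕ.+ 1)
  k²≤k[k+1] = ℕ.*-monoʳ-≤ k (ℕ.m≤m+n k 1)
  doubled : (k * (2 * d) ℕ.∸ m) * 2 ≤ k * (k ℕ.+ 1)
  doubled = begin
    (k * (2 * d) ℕ.∸ m) * 2                        ≡⟨ ℕ.*-comm (k * (2 * d) ℕ.∸ m) 2 ⟩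
    2 * (k * (2 * d) ℕ.∸ m)                        ≡⟨ ℕ.*-distribˡ-∸ 2 (k * (2 * d)) m ⟩
    2 * (k * (2 * d)) ℕ.∸ 2 * m                    ≤⟨ ℕ.∸-monoˡ-≤ (2 * m) (2ab≤a²+b² k (2 * d)) ⟩
    k * k ℕ.+ 2 * d * (2 * d) ℕ.∸ 2 * m            ≤⟨ ℕ.∸-monoˡ-≤ (2 * m) (ℕ.+-mono-≤ k²≤k[k+1] 4d²≤2m) ⟩
    k * (k ℕ.+ 1) ℕ.+ 2 * m ℕ.∸ 2 * m              ≡⟨ ℕ.m+n∸n≡m (k * (k ℕ.+ 1)) (2 * m) ⟩
    k * (k ℕ.+ 1)                                  ∎
    where
    4d²≤2m : 2 * d * (2 * d) ≤ 2 * m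
    4d²≤2m = begin
      2 * d * (2 * d)    ≡⟨ [2d]² ⟩
      4 * d ^ 2          ≤⟨ 4d²≤m+1 ⟩
      m ℕ.+ 1            ≤⟨ ℕ.+-monoʳ-≤ m 1≤m ⟩
      m ℕ.+ m            ≡⟨ cong (m ℕ.+_) (ℕ.*-identityˡ m) ⟨
      2 * m              ∎

-- Eigenvalue bounds

open import Algebra.Definitions.RawSemiring
  (CommutativeSemiring.rawSemiring (CommutativeRing.commutativeSemiring ℝ-commutativeRing))
  using () renaming (_^_ to _^ʳ_)

module ℝ-Determinant = Determinant ℝ-commutativeRing

ι : ℕ → ℚ
ι n = + n ℚ./ 1

ι-+ : ∀ a b → ι (a ℕ.+ b) ≡ ι a ℚ.+ ι b
ι-+ a b = ℚ.toℚᵘ-injective (begin-equality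
  ℚ.toℚᵘ (ι (a ℕ.+ b))             ≃⟨ ℚ.toℚᵘ-fromℚᵘ (ιᵘ (a ℕ.+ b)) ⟩
  ιᵘ (a ℕ.+ b)                     ≃⟨ ℚᵘ.*≡* (cong (ℤ._* + 1) (sym (cong₂ ℤ._+_ (ℤ.*-identityʳ (+ a)) (ℤ.*-identityʳ (+ b))))) ⟩
  ιᵘ a ℚᵘ.+ ιᵘ b                   ≃⟨ ℚᵘ.+-cong (ℚ.toℚᵘ-fromℚᵘ (ιᵘ a)) (ℚ.toℚᵘ-fromℚᵘ (ιᵘ b)) ⟨
  ℚ.toℚᵘ (ι a) ℚᵘ.+ ℚ.toℚᵘ (ι b)   ≃⟨ ℚ.toℚᵘ-homo-+ (ι a) (ι b) ⟨
  ℚ.toℚᵘ (ι a ℚ.+ ι b)             ∎)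
  where
  open ℚᵘ.≤-Reasoning
  ιᵘ : ℕ → ℚᵘ.ℚᵘ
  ιᵘ n = ℚᵘ.mkℚᵘ (+ n) 0

0≤ι : ∀ n → 0ℚ ℚ.≤ ι n
0≤ι n = ℚ.nonNegative⁻¹ (ι n) {{ℚ.normalize-nonNeg n 1}}

ι-mono : ∀ {a b} → a ≤ b → ι a ℚ.≤ ι b
ι-mono {a} {b} a≤b = subst (ι a ℚ.≤_) (trans (sym (ι-+ a (b ℕ.∸ a))) (cong ι (ℕ.m+[n∸m]≡n a≤b)))
  (subst (ℚ._≤ ι a ℚ.+ ι (b ℕ.∸ a)) (ℚ.+-identityʳ (ι a)) (ℚ.+-monoʳ-≤ (ι a) (0≤ι (b ℕ.∸ a))))

ι-∑ : ∀ {n} (f : Vector ℕ n) → ι (∑ℕ f) ≡ ∑ (ι ∘ f)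
ι-∑ {zero}  f = refl
ι-∑ {suc n} f = trans (ι-+ (f zero) (∑ℕ (f ∘ suc))) (cong (ι (f zero) ℚ.+_) (ι-∑ (f ∘ suc)))

neg-/1 : ∀ n → (ℤ.- (+ n)) ℚ./ 1 ≡ ℚ.- ι n
neg-/1 zero    = refl
neg-/1 (suc n) = refl

∑-mono : ∀ {n} {f g : Vector ℚ n} → (∀ j → f j ℚ.≤ g j) → ∑ f ℚ.≤ ∑ g
∑-mono {zero}  f≤g = ℚ.≤-refl
∑-mono {suc n} f≤g = ℚ.+-mono-≤ (f≤g zero) (∑-mono (f≤g ∘ suc))

∑-identity : ∀ {n} c (i : Fin n) → ∑ (λ j → c ℚ.* ℚ-LinearAlgebra.identity i j) ≡ c
∑-identity {suc n} c zero = trans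
  (cong₂ ℚ._+_ (ℚ.*-identityʳ c) (∑-zero {n} (λ _ → c ℚ.* 0ℚ) (λ _ → ℚ.*-zeroʳ c)))
  (ℚ.+-identityʳ c)
∑-identity {suc n} c (suc i) = trans (cong₂ ℚ._+_ (ℚ.*-zeroʳ c) (∑-identity c i)) (ℚ.+-identityˡ c)

shiftedKirchhoff : ∀ G → ℚ → Matrix ℚ (Quiver.n G)
shiftedKirchhoff G x i j = x ℚ.* ℚ-LinearAlgebra.identity i j ℚ.- kirchhoff G i j ℚ./ 1

-- Here `g` is the degree and `μ` the number of loops. Subtracting `μ` gives this bound the same
-- shape as the off-diagonal one, so that both can be summed over the whole row.
diagonal-entry : ∀ x g v {μ} → 0ℚ ℚ.≤ μ → v ≡ 1ℚ →
  (x ℚ.- g) ℚ.* 1ℚ ℚ.+ ℚ.- 1ℚ ℚ.* μ ℚ.≤ (x ℚ.* 1ℚ ℚ.- g) ℚ.* v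
diagonal-entry x g v {μ} 0≤μ v≡1 = begin
  (x ℚ.- g) ℚ.* 1ℚ ℚ.+ ℚ.- 1ℚ ℚ.* μ     ≤⟨ ℚ.+-monoʳ-≤ ((x ℚ.- g) ℚ.* 1ℚ) (ℚ.*-monoˡ-≤-nonPos (ℚ.- 1ℚ) 0≤μ) ⟩
  (x ℚ.- g) ℚ.* 1ℚ ℚ.+ ℚ.- 1ℚ ℚ.* 0ℚ    ≡⟨ simplify x g ⟩
  (x ℚ.* 1ℚ ℚ.- g) ℚ.* 1ℚ               ≡⟨ cong ((x ℚ.* 1ℚ ℚ.- g) ℚ.*_) v≡1 ⟨
  (x ℚ.* 1ℚ ℚ.- g) ℚ.* v                ∎
  where
  open ℚ.≤-Reasoning
  open +-*-Solver
  simplify : ∀ x g → (x ℚ.- g) ℚ.* 1ℚ ℚ.+ ℚ.- 1ℚ ℚ.* 0ℚ ≡ (x ℚ.* 1ℚ ℚ.- g) ℚ.* 1ℚ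
  simplify = solve 2 (λ x g →
    (x :- g) :* con 1ℚ :+ (:- con 1ℚ) :* con 0ℚ := (x :* con 1ℚ :- g) :* con 1ℚ) refl

-- The entry of the shifted matrix is the multiplicity `k` itself, so the worst test value is -1.
off-diagonal-entry : ∀ x g v k → ℚ.- 1ℚ ℚ.≤ v →
  (x ℚ.- g) ℚ.* 0ℚ ℚ.+ ℚ.- 1ℚ ℚ.* ι k ℚ.≤ (x ℚ.* 0ℚ ℚ.- (ℤ.- (+ k)) ℚ./ 1) ℚ.* v
off-diagonal-entry x g v k -1≤v = begin
  (x ℚ.- g) ℚ.* 0ℚ ℚ.+ ℚ.- 1ℚ ℚ.* ι k           ≡⟨ drop-x x g (ι k) ⟩
  ι k ℚ.* (ℚ.- 1ℚ)                              ≤⟨ ℚ.*-monoˡ-≤-nonNeg (ι k) {{ℚ.nonNegative (0≤ι k)}} -1≤v ⟩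
  ι k ℚ.* v                                     ≡⟨ add-x x (ι k) v ⟩
  (x ℚ.* 0ℚ ℚ.- (ℚ.- ι k)) ℚ.* v                ≡⟨ cong (λ z → (x ℚ.* 0ℚ ℚ.- z) ℚ.* v) (neg-/1 k) ⟨
  (x ℚ.* 0ℚ ℚ.- (ℤ.- (+ k)) ℚ./ 1) ℚ.* v        ∎
  where
  open ℚ.≤-Reasoning
  open +-*-Solver
  drop-x : ∀ x g μ → (x ℚ.- g) ℚ.* 0ℚ ℚ.+ ℚ.- 1ℚ ℚ.* μ ≡ μ ℚ.* (ℚ.- 1ℚ)
  drop-x = solve 3 (λ x g μ → (x :- g) :* con 0ℚ :+ (:- con 1ℚ) :* μ := μ :* (:- con 1ℚ)) refl
  add-x : ∀ x μ v → μ ℚ.* v ≡ (x ℚ.* 0ℚ ℚ.- (ℚ.- μ)) ℚ.* v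
  add-x = solve 3 (λ x μ v → μ :* v := (x :* con 0ℚ :- (:- μ)) :* v) refl

-- The degree is lost twice, once on the diagonal and once as a bound for the sum of the
-- multiplicities; this is the origin of the factor 2.
shiftedKirchhoff-dominant : ∀ G {x δ} → ι (2 * maxDegree G) ℚ.+ δ ℚ.≤ x →
                            Dominant δ (shiftedKirchhoff G x)
shiftedKirchhoff-dominant G {x} {δ} 2d+δ≤x i v v∈ vᵢ≡1 = begin
  δ                                                 ≡⟨ insert 2d δ ⟩
  2d ℚ.+ δ ℚ.- 2d                                   ≤⟨ ℚ.+-mono-≤ 2d+δ≤x (ℚ.neg-antimono-≤ 2deg≤2d) ⟩
  x ℚ.- (ι deg ℚ.+ ι deg)                           ≡⟨ regroup x (ι deg) ⟩
  (x ℚ.- ι deg) ℚ.- ι deg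
    ≤⟨ ℚ.+-monoʳ-≤ (x ℚ.- ι deg) (ℚ.neg-antimono-≤ (ι-mono (∑-multiplicity≤degree G i))) ⟩
  (x ℚ.- ι deg) ℚ.- ι (∑ℕ (multiplicity G i))       ≡⟨ expand ⟨
  ∑ (λ j → (x ℚ.- ι deg) ℚ.* I j ℚ.+ ℚ.- 1ℚ ℚ.* ι (multiplicity G i j))
    ≤⟨ ∑-mono entry ⟩
  ∑ (λ j → shiftedKirchhoff G x i j ℚ.* v j)        ∎
  where
  open ℚ.≤-Reasoning
  open +-*-Solver
  deg = degree G i
  2d = ι (2 * maxDegree G)
  I = ℚ-LinearAlgebra.identity i
  insert : ∀ t δ → δ ≡ t ℚ.+ δ ℚ.- t
  insert = solve 2 (λ t δ → δ := t :+ δ :- t) refl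
  regroup : ∀ x g → x ℚ.- (g ℚ.+ g) ≡ (x ℚ.- g) ℚ.- g
  regroup = solve 2 (λ x g → x :- (g :+ g) := (x :- g) :- g) refl
  2deg≤2d : ι deg ℚ.+ ι deg ℚ.≤ 2d
  2deg≤2d = subst (ℚ._≤ 2d) (trans (cong (λ z → ι (deg ℕ.+ z)) (ℕ.+-identityʳ deg)) (ι-+ deg deg))
    (ι-mono (ℕ.*-monoʳ-≤ 2 (≤-maximum (degree G) i)))
  expand : ∑ (λ j → (x ℚ.- ι deg) ℚ.* I j ℚ.+ ℚ.- 1ℚ ℚ.* ι (multiplicity G i j)) ≡
           (x ℚ.- ι deg) ℚ.- ι (∑ℕ (multiplicity G i))
  expand = trans (∑-distrib-+ (λ j → (x ℚ.- ι deg) ℚ.* I j) (λ j → ℚ.- 1ℚ ℚ.* ι (multiplicity G i j)))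
    (cong₂ ℚ._+_ (∑-identity (x ℚ.- ι deg) i)
      (trans (sym (*-distribˡ-sum (ℚ.- 1ℚ) (λ j → ι (multiplicity G i j))))
        (trans (cong (ℚ.- 1ℚ ℚ.*_) (sym (ι-∑ (multiplicity G i)))) (minus-one (ι (∑ℕ (multiplicity G i)))))))
    where
    minus-one : ∀ p → ℚ.- 1ℚ ℚ.* p ≡ ℚ.- p
    minus-one = solve 1 (λ p → (:- con 1ℚ) :* p := :- p) refl
  entry : ∀ j → (x ℚ.- ι deg) ℚ.* I j ℚ.+ ℚ.- 1ℚ ℚ.* ι (multiplicity G i j) ℚ.≤
                shiftedKirchhoff G x i j ℚ.* v j
  entry j with i Fin.≟ j
  ... | yes refl = diagonal-entry x (ι deg) (v i) (0≤ι (multiplicity G i i)) vᵢ≡1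
  ... | no _     = off-diagonal-entry x (ι deg) (v j) (multiplicity G i j) (proj₁ (v∈ j))

seq-^ : ∀ x n t → seq (x ^ʳ n) t ≡ seq x t ^ℚ n
seq-^ x zero    t = refl
seq-^ x (suc n) t = cong (seq x t ℚ.*_) (seq-^ x n t)

seq-sum : ∀ {n} (f : Vector ℝ n) t → seq (sum f) t ≡ ∑ (λ j → seq (f j) t)
seq-sum {zero}  f t = refl
seq-sum {suc n} f t = cong (seq (f zero) t ℚ.+_) (seq-sum (f ∘ suc) t)

seq-product : ∀ {n} (f : Vector ℝ n) t → seq (product f) t ≡ ∏ (λ j → seq (f j) t)
seq-product {zero}  f t = refl
seq-product {suc n} f t = cong (seq (f zero) t ℚ.*_) (seq-product (f ∘ suc) t)

-- The real ring operations act term by term, so the equality is exact at every index and the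
-- rational estimates transfer without passing to a limit.
seq-det : ∀ {n} (A : Matrix ℝ n) t → seq (det A) t ≡ ℚ-LinearAlgebra.det (λ i j → seq (A i j) t)
seq-det {zero}  A t = refl
seq-det {suc n} A t = trans (seq-sum (ℝ-Determinant.laplace A) t) (sum-cong-≗ {suc n} λ j → cong₂ ℚ._*_
  (seq-^ (-ʳ fromℚ 1ℚ) (toℕ j) t)
  (cong (seq (A zero j) t ℚ.*_) (seq-det (λ i k → A (suc i) (punchIn j k)) t)))

seq-charPoly : ∀ G x t →
  seq (charPoly (kirchhoffℝ G) x) t ≡ ℚ-LinearAlgebra.det (shiftedKirchhoff G (seq x t))
seq-charPoly G x t = trans (seq-det (λ i j → x *ʳ identity i j +ʳ (-ʳ kirchhoffℝ G i j)) t)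
  (ℚ-Determinant.det-cong entry)
  where
  entry : ∀ i j → seq (x *ʳ identity i j +ʳ (-ʳ kirchhoffℝ G i j)) t ≡ shiftedKirchhoff G (seq x t) i j
  entry i j with i Fin.≟ j
  ... | yes _ = refl
  ... | no _  = refl

∏-zero : ∀ {n} (f : Vector ℚ n) i → f i ≡ 0ℚ → ∏ f ≡ 0ℚ
∏-zero f zero    fi≡0 = trans (cong (ℚ._* ∏ (f ∘ suc)) fi≡0) (ℚ.*-zeroˡ (∏ (f ∘ suc)))
∏-zero f (suc i) fi≡0 = trans (cong (f zero ℚ.*_) (∏-zero (f ∘ suc) i fi≡0)) (ℚ.*-zeroʳ (f zero))

eigenvalue≤2d : ∀ G (ev : Vector ℝ (Quiver.n G)) → IsSpectrum (kirchhoffℝ G) ev →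
                ∀ i → ev i ≤ʳ fromℕ (2 * maxDegree G)
eigenvalue≤2d G ev (_ , factors) i ε 0<ε =
  -- The tolerance is the lower bound that a margin `ε` forces on the determinant: past `N`, a term
  -- of `ev i` that is at least 2d + `ε` would contradict it.
  let N , near = factors (ev i) (ε ^ℚ Quiver.n G) (^-pos 0<ε (Quiver.n G))
  in N , λ t N≤t → ℚ.≰⇒> λ 2d+ε≤x → ℚ.<-irrefl refl (ℚ.<-≤-trans (near t N≤t) (begin
    ε ^ℚ Quiver.n G
      ≤⟨ dominant⇒δⁿ≤det 0<ε (shiftedKirchhoff G (seq (ev i) t)) (shiftedKirchhoff-dominant G 2d+ε≤x) ⟩
    ℚ-LinearAlgebra.det (shiftedKirchhoff G (seq (ev i) t))
      ≡⟨ seq-charPoly G (ev i) t ⟨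
    seq (χ (ev i)) t
      ≡⟨ ℚ.+-identityʳ _ ⟨
    seq (χ (ev i)) t ℚ.- 0ℚ
      ≡⟨ cong (λ z → seq (χ (ev i)) t ℚ.- z) (vanishes t) ⟨
    seq (χ (ev i)) t ℚ.- seq (product (λ j → ev i +ʳ (-ʳ ev j))) t
      ≤⟨ p≤∣p∣ _ ⟩
    ∣ seq (χ (ev i)) t ℚ.- seq (product (λ j → ev i +ʳ (-ʳ ev j))) t ∣ ∎))
  where
  open ℚ.≤-Reasoning
  χ : ℝ → ℝ
  χ = charPoly (kirchhoffℝ G)
  -- The factor `j = i` is exactly zero at every index.
  vanishes : ∀ t → seq (product (λ j → ev i +ʳ (-ʳ ev j))) t ≡ 0ℚ
  vanishes t = trans (seq-product (λ j → ev i +ʳ (-ʳ ev j)) t)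
    (∏-zero (λ j → seq (ev i +ʳ (-ʳ ev j)) t) i (ℚ.+-inverseʳ (seq (ev i) t)))
  p≤∣p∣ : ∀ p → p ℚ.≤ ∣ p ∣
  p≤∣p∣ p with ℚ.≤-total 0ℚ p
  ... | inj₁ 0≤p = ℚ.≤-reflexive (sym (ℚ.0≤p⇒∣p∣≡p 0≤p))
  ... | inj₂ p≤0 = ℚ.≤-trans p≤0 (ℚ.0≤∣p∣ p)

sum≤ʳ : ∀ {k} (f : Vector ℝ k) c → (∀ j → f j ≤ʳ fromℕ c) → sum f ≤ʳ fromℕ (k * c)
sum≤ʳ {zero} f c f≤c ε 0<ε = 0 , λ _ _ → subst (0ℚ ℚ.<_) (sym (ℚ.+-identityˡ ε)) 0<ε
sum≤ʳ {suc k} f c f≤c ε 0<ε =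
  let M , p = f≤c zero (½ ℚ.* ε) (half-pos 0<ε)
      N , q = sum≤ʳ (f ∘ suc) c (f≤c ∘ suc) (½ ℚ.* ε) (half-pos 0<ε)
  in M ℕ.⊔ N , λ t M⊔N≤t → begin-strict
    seq (f zero) t ℚ.+ seq (sum (f ∘ suc)) t
      <⟨ ℚ.+-mono-< (p t (ℕ.m⊔n≤o⇒m≤o M N M⊔N≤t)) (q t (ℕ.m⊔n≤o⇒n≤o M N M⊔N≤t)) ⟩
    (ι c ℚ.+ ½ ℚ.* ε) ℚ.+ (ι (k * c) ℚ.+ ½ ℚ.* ε)
      ≡⟨ regroup (ι c) (ι (k * c)) (½ ℚ.* ε) ⟩
    (ι c ℚ.+ ι (k * c)) ℚ.+ (½ ℚ.* ε ℚ.+ ½ ℚ.* ε)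
      ≡⟨ cong₂ ℚ._+_ (ι-+ c (k * c)) (sym (half+half ε)) ⟨
    ι (suc k * c) ℚ.+ ε ∎
  where
  open ℚ.≤-Reasoning
  open +-*-Solver
  regroup : ∀ a b h → (a ℚ.+ h) ℚ.+ (b ℚ.+ h) ≡ (a ℚ.+ b) ℚ.+ (h ℚ.+ h)
  regroup = solve 3 (λ a b h → (a :+ h) :+ (b :+ h) := (a :+ b) :+ (h :+ h)) refl

≤ʳ-weaken : ∀ {x a b} → x ≤ʳ fromℕ a → a ≤ b → x ≤ʳ fromℕ b
≤ʳ-weaken x≤a a≤b ε 0<ε =
  let N , p = x≤a ε 0<ε in N , λ t N≤t → ℚ.<-≤-trans (p t N≤t) (ℚ.+-monoˡ-≤ ε (ι-mono a≤b))

theorem3 : (G : Quiver) → Connected G →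
    4 * maxDegree G ^ 2 ≤ Quiver.n G →
    (ev : Vector ℝ (Quiver.n G)) → IsSpectrum (kirchhoffℝ G) ev →
    (k : ℕ) → 1 ≤ k → (k≤n : k ≤ Quiver.n G) →
    partialSum ev k≤n ≤ʳ fromℕ (brouwerBound G k)
theorem3 G connected 4d²≤n ev spectrum k _ k≤n = ≤ʳ-weaken {partialSum ev k≤n}
  (sum≤ʳ (λ i → ev (inject≤ i k≤n)) (2 * maxDegree G)
    (λ i → eigenvalue≤2d G ev spectrum (inject≤ i k≤n)))
  (brouwerBound-arithmetic (Quiver.m G) (redundancy G) (Quiver.n G) (maxDegree G) k
    4d²≤n (connected⇒n≤m+1 G connected))
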